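{- Let $s,t\geq 1$ be integers and let $p,q,l$ be three distinct primes with $p,q$ odd, $p\equiv 3 \pmod 4$, $\mathrm{ord}_{p^s}(l)=\phi(p^s)/2$, $\mathrm{ord}_{q^t}(l)=\phi(q^t)$ and $\gcd(\phi(p^s),\phi(q^t))=2$. Let $0\leq i\leq s-1$. Then in the ring $\mathbb{F}_l[x]/\langle x^{p^sq^t}-1\rangle$: (i) $\chi_{it}^2=\frac{p-3}{4}p^{s-i-1}\chi_{it}+\frac{p+1}{4}p^{s-i-1}\chi_{it}^*$. (ii) $(\chi_{it}^*)^2=\frac{p-3}{4}p^{s-i-1}\chi_{it}^*+\frac{p+1}{4}p^{s-i-1}\chi_{it}$. (iii) $\chi_{it}\chi_{it}^*=\frac{p-3}{4}p^{s-i-1}(\chi_{it}+\chi_{it}^*)+\frac{\phi(p^{s-i})}{2}\Big(\sum_{i<k\leq s-1}(\chi_{kt}+\chi_{kt}^*)+1\Big)$.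
   Context: Here $\phi$ is Euler's phi function (with $\phi(1)=1$) and $\mathrm{ord}_m(k)$ is the multiplicative order of $k$ modulo $m$. Put $n=p^sq^t$. Fix an integer $g$ that is a primitive root both modulo $p^s$ and modulo $q^t$. For an integer $\gamma$, $C_\gamma=\{\gamma l^r \bmod n: r\geq 0\}\subseteq \mathbb{Z}_n$ is the $l$-cyclotomic coset modulo $n$ containing $\gamma$. For $0\leq i\leq s$, $0\leq j\leq t$ set $C_{ij}=C_{p^iq^j}$ and $C_{ij}^*=C_{p^iq^jg}$; in particular $C_{sj}=C_{sj}^*$ and $C_{st}=C_0=\{0\}$. Define elements of $\mathbb{F}_l[x]/\langle x^{n}-1\rangle$ by $\chi_{ij}=\sum_{\alpha\in C_{ij}}x^\alpha$ and $\chi_{ij}^*=\sum_{\alpha\in C_{ij}^*}x^\alpha$; in particular $\chi_{sj}=\chi_{sj}^*$ and $\chi_{st}=1$. Integer coefficients are read in $\mathbb{F}_l$, and empty sums are $0$. -}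

module Defs where

open import Algebra.Bundles.Raw using (RawRing)
open import Data.Fin.Base using (Fin; toℕ; fromℕ<)
open import Data.Fin.Properties using (any?; pigeonhole; toℕ-fromℕ<; toℕ≤pred[n])
open import Data.Integer.Base using (ℤ; +_; _-_; _%ℕ_; _/ℕ_)
import Data.Integer.Base as ℤ
open import Data.Integer.DivMod using (n%ℕd<d; a≡a%ℕn+[a/ℕn]*n)
open import Data.Integer.Divisibility.Signed using (_∣_; divides; _∣?_)
import Data.Integer.Properties as ℤ
open import Data.Integer.Tactic.RingSolver using (solve-∀)
open import Data.List.Base using (List; []; _∷_; _++_; allFin; filter; foldr; length; map; replicate; upTo)
open import Data.Nat.Base as ℕ using (ℕ; zero; suc; NonZero; _≤_; _<_; _^_; _∸_)
open import Data.Nat.Coprimality using (coprime?)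
open import Data.Nat.Induction using (Acc; acc; <-wellFounded)
import Data.Nat.Properties as ℕ
open import Data.Product.Base using (∃; _×_; _,_)
open import Level using (Level; 0ℓ; _⊔_)
open import Relation.Binary.PropositionalEquality
open import Relation.Nullary using (Dec; yes; no)
open import Relation.Nullary.Decidable using (map′)

infix 4 _≋_[mod_]

_≋_[mod_] : ℤ → ℤ → ℕ → Set
a ≋ b [mod m ] = + m ∣ a - b

≋-trans : ∀ {m} a b c → a ≋ b [mod m ] → b ≋ c [mod m ] → a ≋ c [mod m ]
≋-trans {m} a b c (divides x p) (divides y q) = divides (x ℤ.+ y) (begin
  a - c                        ≡⟨ telescope a b c ⟩
  (a - b) ℤ.+ (b - c)          ≡⟨ cong₂ ℤ._+_ p q ⟩
  x ℤ.* + m ℤ.+ y ℤ.* + m      ≡⟨ ℤ.*-distribʳ-+ (+ m) x y ⟨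
  (x ℤ.+ y) ℤ.* + m            ∎)
  where
  open ≡-Reasoning
  telescope : ∀ a b c → a - c ≡ (a - b) ℤ.+ (b - c)
  telescope = solve-∀

≋-refl : ∀ {m} a → a ≋ a [mod m ]
≋-refl a = divides (+ 0) (ℤ.+-inverseʳ a)

≋-*ʳ : ∀ {m} a b c → a ≋ b [mod m ] → a ℤ.* c ≋ b ℤ.* c [mod m ]
≋-*ʳ {m} a b c (divides x p) = divides (x ℤ.* c) (begin
  a ℤ.* c - b ℤ.* c     ≡⟨ factor a b c ⟩
  (a - b) ℤ.* c         ≡⟨ cong (ℤ._* c) p ⟩
  x ℤ.* + m ℤ.* c       ≡⟨ swap x (+ m) c ⟩
  x ℤ.* c ℤ.* + m       ∎)
  where
  open ≡-Reasoning
  factor : ∀ a b c → a ℤ.* c - b ℤ.* c ≡ (a - b) ℤ.* c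
  factor = solve-∀
  swap : ∀ x y z → x ℤ.* y ℤ.* z ≡ x ℤ.* z ℤ.* y
  swap = solve-∀

%≡⇒≋ : ∀ a b m .{{_ : NonZero m}} → a %ℕ m ≡ b %ℕ m → a ≋ b [mod m ]
%≡⇒≋ a b m eq = divides (a /ℕ m - b /ℕ m) (begin
  a - b
    ≡⟨ cong₂ _-_ (a≡a%ℕn+[a/ℕn]*n a m) (a≡a%ℕn+[a/ℕn]*n b m) ⟩
  (+ (a %ℕ m) ℤ.+ a /ℕ m ℤ.* + m) - (+ (b %ℕ m) ℤ.+ b /ℕ m ℤ.* + m)
    ≡⟨ cong (λ z → (+ z ℤ.+ a /ℕ m ℤ.* + m) - (+ (b %ℕ m) ℤ.+ b /ℕ m ℤ.* + m)) eq ⟩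
  (+ (b %ℕ m) ℤ.+ a /ℕ m ℤ.* + m) - (+ (b %ℕ m) ℤ.+ b /ℕ m ℤ.* + m)
    ≡⟨ cancel (+ (b %ℕ m)) (a /ℕ m) (b /ℕ m) (+ m) ⟩
  (a /ℕ m - b /ℕ m) ℤ.* + m ∎)
  where
  open ≡-Reasoning
  cancel : ∀ z x y m → (z ℤ.+ x ℤ.* m) - (z ℤ.+ y ℤ.* m) ≡ (x - y) ℤ.* m
  cancel = solve-∀

-- Counting over 0, …, m - 1 instead of 1, …, m is harmless, since 0 and m
-- are coprime to m under the same circumstances; in particular φ 1 = 1.
φ : ℕ → ℕ
φ m = length (filter (coprime? m) (upTo m))

record Order (m : ℕ) (k : ℤ) (d : ℕ) : Set where
  field
    positive : 0 < d
    power    : k ℤ.^ d ≋ + 1 [mod m ]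
    minimal  : ∀ e → 0 < e → k ℤ.^ e ≋ + 1 [mod m ] → d ≤ e

PrimitiveRoot : ℕ → ℤ → Set
PrimitiveRoot m g = Order m g (φ m)

𝔽 : ℕ → RawRing 0ℓ 0ℓ
𝔽 l = record
  { Carrier = ℤ
  ; _≈_     = _≋_[mod l ]
  ; _+_     = ℤ._+_
  ; _*_     = ℤ._*_
  ; -_      = ℤ.-_
  ; 0#      = + 0
  ; 1#      = + 1
  }

-- A polynomial is its list of coefficients, constant term first.  Trailing
-- zeros are allowed, and are ignored by _≈ᴾ_.
module Polynomial {c ℓ : Level} (R : RawRing c ℓ) where
  open RawRing R

  Poly : Set c
  Poly = List Carrier

  coeff : Poly → ℕ → Carrier
  coeff []      _       = 0#
  coeff (a ∷ _) zero    = a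
  coeff (_ ∷ f) (suc k) = coeff f k

  infix  4 _≈ᴾ_
  infixl 6 _+ᴾ_
  infixl 7 _*ᴾ_

  _≈ᴾ_ : Poly → Poly → Set ℓ
  f ≈ᴾ g = ∀ k → coeff f k ≈ coeff g k

  _+ᴾ_ : Poly → Poly → Poly
  []      +ᴾ g       = g
  (a ∷ f) +ᴾ []      = a ∷ f
  (a ∷ f) +ᴾ (b ∷ g) = (a + b) ∷ (f +ᴾ g)

  _*ᴾ_ : Poly → Poly → Poly
  []      *ᴾ g = []
  (a ∷ f) *ᴾ g = map (a *_) g +ᴾ (0# ∷ (f *ᴾ g))

  constant : Carrier → Poly
  constant a = a ∷ []

  X^_ : ℕ → Poly
  X^ k = replicate k 0# ++ (1# ∷ [])

  polynomialRing : RawRing c ℓ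
  polynomialRing = record
    { Carrier = Poly
    ; _≈_     = _≈ᴾ_
    ; _+_     = _+ᴾ_
    ; _*_     = _*ᴾ_
    ; -_      = map (λ a → - a)
    ; 0#      = []
    ; 1#      = constant 1#
    }

-- The quotient by the principal ideal generated by m: the same elements and
-- operations, with f ≈ g when f - g is a multiple of m.
_/⟨_⟩ : ∀ {c ℓ} (A : RawRing c ℓ) → RawRing.Carrier A → RawRing c (c ⊔ ℓ)
A /⟨ m ⟩ = record
  { Carrier = Carrier
  ; _≈_     = λ f g → ∃ λ h → f + (- g) ≈ h * m
  ; _+_     = _+_
  ; _*_     = _*_
  ; -_      = -_
  ; 0#      = 0#
  ; 1#      = 1#
  }
  where open RawRing A

-- InCoset n l γ α says that α lies in { γ l^r mod n : r ≥ 0 }, where Fin n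
-- is ℤ_n.
InCoset : (n l : ℕ) (γ : ℤ) → Fin n → Set
InCoset n l γ α = ∃ λ r → + toℕ α ≋ γ ℤ.* + (l ^ r) [mod n ]

private
  module _ (n l : ℕ) (γ : ℤ) .{{_ : NonZero n}} where

    term : ℕ → ℤ
    term r = γ ℤ.* + (l ^ r)

    shift : ∀ r k → term (r ℕ.+ k) ≡ term r ℤ.* + (l ^ k)
    shift r k = begin
      γ ℤ.* + (l ^ (r ℕ.+ k))         ≡⟨ cong (λ z → γ ℤ.* + z) (ℕ.^-distribˡ-+-* l r k) ⟩
      γ ℤ.* + (l ^ r ℕ.* l ^ k)       ≡⟨ cong (γ ℤ.*_) (ℤ.pos-* (l ^ r) (l ^ k)) ⟩
      γ ℤ.* (+ (l ^ r) ℤ.* + (l ^ k)) ≡⟨ ℤ.*-assoc γ (+ (l ^ r)) (+ (l ^ k)) ⟨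
      term r ℤ.* + (l ^ k)            ∎
      where open ≡-Reasoning

    -- By the pigeonhole principle every element of the coset occurs among
    -- the first n terms of γ, γ l, γ l², ….
    early : ∀ r → Acc _<_ r → ∃ λ r′ → r′ < n × term r ≋ term r′ [mod n ]
    early r (acc rec) with r ℕ.<? n
    ... | yes r<n = r , r<n , ≋-refl (term r)
    ... | no r≮n
      with i , j , i<j , eq ← pigeonhole (ℕ.n<1+n n) (λ (k : Fin (suc n)) → fromℕ< (n%ℕd<d (term (toℕ k)) n))
      = let i′ = toℕ i ; j′ = toℕ j ; k = r ∸ j′
            j≤r : j′ ≤ r
            j≤r = ℕ.≤-trans (toℕ≤pred[n] j) (ℕ.≮⇒≥ r≮n)
            j+k≡r : j′ ℕ.+ k ≡ r
            j+k≡r = ℕ.m+[n∸m]≡n j≤r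
            residues : term j′ %ℕ n ≡ term i′ %ℕ n
            residues = trans (sym (toℕ-fromℕ< _)) (trans (cong toℕ (sym eq)) (toℕ-fromℕ< _))
            same : term (j′ ℕ.+ k) ≋ term (i′ ℕ.+ k) [mod n ]
            same = subst₂ _≋_[mod n ] (sym (shift j′ k)) (sym (shift i′ k))
                     (≋-*ʳ (term j′) (term i′) (+ (l ^ k)) (%≡⇒≋ (term j′) (term i′) n residues))
            smaller : i′ ℕ.+ k < r
            smaller = subst (i′ ℕ.+ k <_) j+k≡r (ℕ.+-monoˡ-< k i<j)
            r′ , r′<n , e = early (i′ ℕ.+ k) (rec smaller)
        in r′ , r′<n , ≋-trans (term r) (term (i′ ℕ.+ k)) (term r′)
                            (subst (λ z → term z ≋ term (i′ ℕ.+ k) [mod n ]) j+k≡r same) e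

inCoset? : ∀ n l γ (α : Fin n) → Dec (InCoset n l γ α)
inCoset? n@(suc _) l γ α =
  map′ (λ (r , e) → toℕ r , e) bounded
       (any? λ (r : Fin n) → + n ∣? (+ toℕ α - γ ℤ.* + (l ^ toℕ r)))
  where
  bounded : InCoset n l γ α → ∃ λ (r : Fin n) → + toℕ α ≋ γ ℤ.* + (l ^ toℕ r) [mod n ]
  bounded (r , e) with r′ , r′<n , e′ ← early n l γ r (<-wellFounded r) =
    fromℕ< r′<n ,
    subst (λ z → + toℕ α ≋ γ ℤ.* + (l ^ z) [mod n ]) (sym (toℕ-fromℕ< r′<n))
      (≋-trans (+ toℕ α) (γ ℤ.* + (l ^ r)) (γ ℤ.* + (l ^ r′)) e e′)

coset : (n l : ℕ) → ℤ → List (Fin n)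
coset n l γ = filter (inCoset? n l γ) (allFin n)

module CyclicRing (p q l s t : ℕ) (g : ℤ) where

  n : ℕ
  n = p ^ s ℕ.* q ^ t

  open Polynomial (𝔽 l)

  xⁿ-1 : Poly
  xⁿ-1 = (X^ n) +ᴾ constant (ℤ.- (+ 1))

  open RawRing (polynomialRing /⟨ xⁿ-1 ⟩) public

  ∑ : {A : Set} → List A → (A → Carrier) → Carrier
  ∑ xs f = foldr _+_ 0# (map f xs)

  ⟦_⟧ : ℕ → Carrier
  ⟦ a ⟧ = constant (+ a)

  χ : ℕ → ℕ → Carrier
  χ i j = ∑ (coset n l (+ (p ^ i ℕ.* q ^ j))) (λ α → X^ (toℕ α))

  χ* : ℕ → ℕ → Carrier
  χ* i j = ∑ (coset n l (+ (p ^ i ℕ.* q ^ j) ℤ.* g)) (λ α → X^ (toℕ α))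

{-# OPTIONS --safe #-}

-- Summing the coefficients of a polynomial along residue classes modulo n
-- identifies 𝔽_l[x]/⟨xⁿ - 1⟩ with functions on ℤ_n under convolution, and the
-- identities already hold for these functions over ℤ.  Put M = pⁱqᵗ.  Since l
-- has odd order φ(pˢ)/2 modulo pˢ, the units modulo pˢ are the powers of l and
-- their negatives, and -1, like g, is not a power of l; whether a unit is a power
-- of l depends only on its class modulo p.  Hence χ and χ* live on the multiples
-- M x of M, with values e(x) and e(-x), where e is the indicator of the powers
-- of l modulo p.  The number N(d) of pairs of such powers with difference d is
-- even in d and invariant under multiplication by powers of l, so it is constant
-- on units, which gives χχ*; and χ² follows from e(x) + e(-x) = 1 - [p ∣ x].
module Submission where

open import Defs
open import Data.Integer.Base using (ℤ; +_)
open import Data.List.Base using (filter; upTo)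
open import Data.Nat.Base as ℕ using (ℕ; _≤_; _<_; _^_; _∸_; _/_; _%_)
open import Data.Nat.Divisibility using (_∣_)
open import Data.Nat.GCD using (gcd)
open import Data.Nat.Primality using (Prime)
open import Data.Nat.Properties using (_<?_)
open import Data.Product.Base using (_×_)
open import Relation.Binary.PropositionalEquality using (_≡_; _≢_)
open import Relation.Nullary using (¬_)

open import Algebra.Bundles using (module AbelianGroup)
open import Data.Bool.Base using (if_then_else_)
open import Data.Fin.Base as Fin using (Fin; toℕ; fromℕ<)
open import Data.Fin.Permutation using (permutation)
open import Data.Fin.Properties using (pigeonhole; toℕ<n; toℕ-fromℕ<; toℕ-injective)
import Data.Integer.Base as ℤ
open import Data.Integer.DivMod using (n%ℕd<d; a≡a%ℕn+[a/ℕn]*n)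
import Data.Integer.Divisibility.Signed as ∣
import Data.Integer.Properties as ℤ
open import Data.Integer.Tactic.RingSolver using (solve-∀)
open import Data.List.Base using ([]; _∷_; _++_; allFin; applyUpTo; foldr; length; map; tabulate)
open import Data.List.Membership.Propositional using (_∈_)
open import Data.List.Membership.Propositional.Properties using (∈-filter⁺; ∈-upTo⁺)
import Data.List.Membership.Setoid.Properties as Membership
import Data.List.Properties as List
open import Data.List.Relation.Unary.Any using (index)
open import Data.Nat.Base using (zero; suc; NonZero; z≤n; s≤s)
open import Data.Nat.Coprimality using (Coprime; coprime?; coprime-divisor)
import Data.Nat.DivMod as ℕ
import Data.Nat.Divisibility as ℕ
open import Data.Nat.Primality using (prime⇒irreducible; prime⇒nonTrivial; prime⇒nonZero)
import Data.Nat.Properties as ℕ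
import Data.Nat.Tactic.RingSolver as ℕ-Solver
open import Data.Product.Base using (∃; _,_)
open import Data.Sum.Base using (_⊎_; inj₁; inj₂; [_,_]′)
open import Function.Base using (_∘_; id)
open import Relation.Binary.Definitions using (Tri; tri<; tri≈; tri>)
open import Relation.Binary.PropositionalEquality
  using (cong; cong₂; module ≡-Reasoning; refl; setoid; subst; subst₂; sym; trans)
open import Relation.Nullary using (Dec; contradiction; does; no; yes)

-- The elements of 𝔽_l are represented by integers, so equality of integer functions is enough, and
-- over ℤ the number h of powers of l modulo p can be cancelled, which need not be possible in 𝔽_l.
-- This cancellation fixes the constants. Let a be the value of N on units. Counting pairs of powers
-- by their difference gives h² = 2ah + h, so h = 2a + 1 and p = 2h + 1 = 4a + 3. The coefficients
-- are thus a = (p - 3)/4 and a + 1 = (p + 1)/4. The factor p^(s-i-1) appears because the x in M x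
-- counts modulo p^(s-i), while e depends on x modulo p only. The bracket in (iii) is the indicator
-- of the multiples of pM: the pair at level k is the indicator of the multiples of p^k q^t minus
-- that of the multiples of p^(k+1) q^t, so the sum telescopes, and the summand 1 restores the
-- multiples of n.

module Development where

  open import Algebra.Properties.Group (AbelianGroup.group ℤ.+-0-abelianGroup) using (∙-cancelˡ)
  open import Algebra.Properties.Semiring.Sum ℤ.+-*-semiring
    using (sum; sum-cong-≗; ∑-distrib-+; ∑-comm; sum-permute; *-distribˡ-sum; sum-replicate-zero)
  open import Data.Integer.Base using (-_; _+_; _-_; _*_; _%ℕ_; _/ℕ_; 0ℤ; 1ℤ; -1ℤ)
  open import Data.Integer.Divisibility.Signed using (divides) renaming (_∣_ to _∣ᶻ_; _∣?_ to _∣ᶻ?_)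

  -- Sums over a period

  -- A record, unlike _≋_[mod_], lets the two sides be inferred.
  infix 4 _≅_[_]
  record _≅_[_] (a b : ℤ) (m : ℕ) : Set where
    constructor ⌊_⌋
    field ⌈_⌉ : a ≋ b [mod m ]
  open _≅_[_]

  module _ {m : ℕ} where

    ≡⇒≅ : ∀ {a b} → a ≡ b → a ≅ b [ m ]
    ≡⇒≅ {a} refl = ⌊ ≋-refl a ⌋

    ≅-refl : ∀ {a} → a ≅ a [ m ]
    ≅-refl = ≡⇒≅ refl

    ≅-trans : ∀ {a b c} → a ≅ b [ m ] → b ≅ c [ m ] → a ≅ c [ m ]
    ≅-trans {a} {b} {c} ⌊ x ⌋ ⌊ y ⌋ = ⌊ ≋-trans a b c x y ⌋

    ≅-sym : ∀ {a b} → a ≅ b [ m ] → b ≅ a [ m ]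
    ≅-sym {a} {b} ⌊ x ⌋ = ⌊ subst (+ m ∣ᶻ_) (flip a b) (∣.∣m⇒∣-m x) ⌋
      where
      flip : ∀ a b → - (a - b) ≡ b - a
      flip = solve-∀

    +-cong-≅ : ∀ {a b c d} → a ≅ b [ m ] → c ≅ d [ m ] → a + c ≅ b + d [ m ]
    +-cong-≅ {a} {b} {c} {d} ⌊ x ⌋ ⌊ y ⌋ = ⌊ subst (+ m ∣ᶻ_) (eq a b c d) (∣.∣m∣n⇒∣m+n x y) ⌋
      where
      eq : ∀ a b c d → (a - b) + (c - d) ≡ a + c - (b + d)
      eq = solve-∀

    neg-cong-≅ : ∀ {a b} → a ≅ b [ m ] → - a ≅ - b [ m ]
    neg-cong-≅ {a} {b} ⌊ x ⌋ = ⌊ subst (+ m ∣ᶻ_) (eq a b) (∣.∣m⇒∣-m x) ⌋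
      where
      eq : ∀ a b → - (a - b) ≡ - a - - b
      eq = solve-∀

    *-cong-≅ : ∀ {a b c d} → a ≅ b [ m ] → c ≅ d [ m ] → a * c ≅ b * d [ m ]
    *-cong-≅ {a} {b} {c} {d} ⌊ x ⌋ ⌊ y ⌋ =
      ⌊ subst (+ m ∣ᶻ_) (eq a b c d) (∣.∣m∣n⇒∣m+n (∣.∣m⇒∣m*n c x) (∣.∣n⇒∣m*n b y)) ⌋
      where
      eq : ∀ a b c d → (a - b) * c + b * (c - d) ≡ a * c - b * d
      eq = solve-∀

    +-congˡ-≅ : ∀ a {c d} → c ≅ d [ m ] → a + c ≅ a + d [ m ]
    +-congˡ-≅ a = +-cong-≅ (≅-refl {a})

    *-congˡ-≅ : ∀ a {c d} → c ≅ d [ m ] → a * c ≅ a * d [ m ]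
    *-congˡ-≅ a = *-cong-≅ (≅-refl {a})

    *-congʳ-≅ : ∀ c {a b} → a ≅ b [ m ] → a * c ≅ b * c [ m ]
    *-congʳ-≅ c a≅b = *-cong-≅ a≅b (≅-refl {c})

    ^-cong-≅ : ∀ {a b} k → a ≅ b [ m ] → a ℤ.^ k ≅ b ℤ.^ k [ m ]
    ^-cong-≅ zero    e = ≅-refl
    ^-cong-≅ (suc k) e = *-cong-≅ e (^-cong-≅ k e)

    ∣⇒≅0 : ∀ {a} → + m ∣ᶻ a → a ≅ 0ℤ [ m ]
    ∣⇒≅0 {a} x = ⌊ subst (+ m ∣ᶻ_) (sym (ℤ.+-identityʳ a)) x ⌋

    ≅0⇒∣ : ∀ {a} → a ≅ 0ℤ [ m ] → + m ∣ᶻ a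
    ≅0⇒∣ {a} ⌊ x ⌋ = subst (+ m ∣ᶻ_) (ℤ.+-identityʳ a) x

    ∣-resp-≅ : ∀ {a b} → a ≅ b [ m ] → + m ∣ᶻ a → + m ∣ᶻ b
    ∣-resp-≅ e x = ≅0⇒∣ (≅-trans (≅-sym e) (∣⇒≅0 x))

    +km-≅ : ∀ a k → k * + m + a ≅ a [ m ]
    +km-≅ a k = ⌊ divides k (eq k (+ m) a) ⌋
      where
      eq : ∀ k m a → k * m + a - a ≡ k * m
      eq = solve-∀

    ≅-%ℕ : ∀ a .{{_ : NonZero m}} → a ≅ + (a %ℕ m) [ m ]
    ≅-%ℕ a = ≅-trans (≡⇒≅ (trans (a≡a%ℕn+[a/ℕn]*n a m) (ℤ.+-comm (+ (a %ℕ m)) (a /ℕ m * + m)))) (+km-≅ _ (a /ℕ m))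

    small-≅⇒≡ : ∀ {a b} → a ℕ.< m → b ℕ.< m → + a ≅ + b [ m ] → a ≡ b
    small-≅⇒≡ {a} {b} a<m b<m ⌊ x ⌋ with ℤ.∣ + a - + b ∣ in eq | ∣.∣⇒∣ᵤ x
    ... | zero  | _ = ℤ.+-injective (ℤ.i-j≡0⇒i≡j (+ a) (+ b) (ℤ.∣i∣≡0⇒i≡0 eq))
    ... | suc k | y = contradiction (ℕ.∣⇒≤ y) (ℕ.<⇒≱ (subst (ℕ._< m) eq
      (ℕ.≤-<-trans (subst (λ z → ℤ.∣ z ∣ ℕ.≤ a ℕ.⊔ b) (sym (ℤ.m-n≡m⊖n a b)) (ℤ.∣m⊝n∣≤m⊔n a b))
                   (ℕ.⊔-lub a<m b<m))))

  ≅-∣ : ∀ {m n a b} → n ℕ.∣ m → a ≅ b [ m ] → a ≅ b [ n ]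
  ≅-∣ n∣m ⌊ x ⌋ = ⌊ ∣.∣-trans (∣.∣ᵤ⇒∣ n∣m) x ⌋

  -- Summands live on all of ℤ, so that arguments can be shifted, negated or scaled without
  -- reduction; `Periodic` restores independence of the representatives.
  S : ℕ → (ℤ → ℤ) → ℤ
  S n f = sum {n} (λ i → f (+ toℕ i))

  Periodic : ℕ → (ℤ → ℤ) → Set
  Periodic n f = ∀ {x y} → x ≅ y [ n ] → f x ≡ f y

  S-cong : ∀ n {f g : ℤ → ℤ} → (∀ x → f x ≡ g x) → S n f ≡ S n g
  S-cong n eq = sum-cong-≗ {n} (λ i → eq (+ toℕ i))

  S-+ : ∀ n (f g : ℤ → ℤ) → S n (λ x → f x + g x) ≡ S n f + S n g
  S-+ n f g = ∑-distrib-+ {n} (λ i → f (+ toℕ i)) (λ i → g (+ toℕ i))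

  S-* : ∀ n c (f : ℤ → ℤ) → S n (λ x → c * f x) ≡ c * S n f
  S-* n c f = sym (*-distribˡ-sum {n} c (λ i → f (+ toℕ i)))

  S-0 : ∀ n {f : ℤ → ℤ} → (∀ x → f x ≡ 0ℤ) → S n f ≡ 0ℤ
  S-0 n eq = trans (S-cong n eq) (sum-replicate-zero n)

  S-neg : ∀ n (f : ℤ → ℤ) → S n (λ x → - f x) ≡ - S n f
  S-neg n f = trans (S-cong n (λ x → sym (ℤ.-1*i≡-i (f x)))) (trans (S-* n (- 1ℤ) f) (ℤ.-1*i≡-i (S n f)))

  S-comm : ∀ m n (f : ℤ → ℤ → ℤ) → S m (λ x → S n (f x)) ≡ S n (λ y → S m (λ x → f x y))
  S-comm m n f = ∑-comm {m} {n} (λ i j → f (+ toℕ i) (+ toℕ j))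

  S-const : ∀ n c → S n (λ _ → c) ≡ + n * c
  S-const zero    c = refl
  S-const (suc n) c = trans (cong₂ _+_ {c} refl (S-const n c)) (eq c (+ n))
    where
    eq : ∀ c n → c + n * c ≡ (1ℤ + n) * c
    eq = solve-∀

  S-+-split : ∀ m k (f : ℤ → ℤ) → S (m ℕ.+ k) f ≡ S m f + S k (λ x → f (+ m + x))
  S-+-split zero    k f = sym (trans (ℤ.+-identityˡ _) (S-cong k (λ x → cong f (ℤ.+-identityˡ x))))
  S-+-split (suc m) k f = begin
    f 0ℤ + S (m ℕ.+ k) (λ x → f (1ℤ + x))
      ≡⟨ cong₂ _+_ {f 0ℤ} refl (S-+-split m k (λ x → f (1ℤ + x))) ⟩
    f 0ℤ + (S m (λ x → f (1ℤ + x)) + S k (λ x → f (1ℤ + (+ m + x))))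
      ≡⟨ ℤ.+-assoc (f 0ℤ) _ _ ⟨
    S (suc m) f + S k (λ x → f (1ℤ + (+ m + x)))
      ≡⟨ cong₂ _+_ {S (suc m) f} refl (S-cong k (λ x → cong f (sym (ℤ.+-assoc 1ℤ (+ m) x)))) ⟩
    S (suc m) f + S k (λ x → f (+ suc m + x)) ∎
    where open ≡-Reasoning

  S-blocks : ∀ m n (f : ℤ → ℤ) → S (m ℕ.* n) f ≡ S m (λ x → S n (λ y → f (x * + n + y)))
  S-blocks zero    n f = refl
  S-blocks (suc m) n f = begin
    S (n ℕ.+ m ℕ.* n) f
      ≡⟨ S-+-split n (m ℕ.* n) f ⟩
    S n f + S (m ℕ.* n) (λ x → f (+ n + x))
      ≡⟨ cong₂ _+_ (S-cong n (λ y → cong f (sym (ℤ.+-identityˡ y))))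
                   (S-blocks m n (λ x → f (+ n + x))) ⟩
    S n (λ y → f (0ℤ * + n + y)) + S m (λ x → S n (λ y → f (+ n + (x * + n + y))))
      ≡⟨ cong₂ _+_ {S n (λ y → f (0ℤ * + n + y))} refl
           (S-cong m (λ x → S-cong n (λ y → cong f (eq (+ n) x y)))) ⟩
    S (suc m) (λ x → S n (λ y → f (x * + n + y))) ∎
    where
    open ≡-Reasoning
    eq : ∀ n x y → n + (x * n + y) ≡ (1ℤ + x) * n + y
    eq = solve-∀

  S-periodic : ∀ m n {f : ℤ → ℤ} → Periodic n f → S (m ℕ.* n) f ≡ + m * S n f
  S-periodic m n {f} per = trans (S-blocks m n f)
    (trans (S-cong m (λ x → S-cong n (λ y → per (+km-≅ y x)))) (S-const m (S n f)))

  sum-single : ∀ {n} (t : Fin n → ℤ) i → (∀ j → j ≢ i → t j ≡ 0ℤ) → sum t ≡ t i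
  sum-single {suc n} t Fin.zero z =
    trans (cong₂ _+_ {t Fin.zero} refl (trans (sum-cong-≗ {n} (λ j → z (Fin.suc j) λ ())) (sum-replicate-zero n)))
          (ℤ.+-identityʳ _)
  sum-single {suc n} t (Fin.suc i) z =
    trans (cong₂ _+_ (z Fin.zero λ ()) (sum-single (t ∘ Fin.suc) i (λ j j≢i → z (Fin.suc j) λ { refl → j≢i refl })))
          (ℤ.+-identityˡ _)

  module _ {n : ℕ} .{{_ : NonZero n}} where

    residue : ℤ → Fin n
    residue x = fromℕ< (n%ℕd<d x n)

    residue-≅ : ∀ x → + toℕ (residue x) ≅ x [ n ]
    residue-≅ x = ≅-trans (≡⇒≅ (cong +_ (toℕ-fromℕ< _))) (≅-sym (≅-%ℕ x))

    toℕ-≅-injective : ∀ {i j : Fin n} → + toℕ i ≅ + toℕ j [ n ] → i ≡ j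
    toℕ-≅-injective {i} {j} e = toℕ-injective (small-≅⇒≡ (toℕ<n i) (toℕ<n j) e)

    S-single : ∀ {f : ℤ → ℤ} d → Periodic n f → (∀ x → ¬ x ≅ d [ n ] → f x ≡ 0ℤ) → S n f ≡ f d
    S-single {f} d per z = trans
      (sum-single (λ i → f (+ toℕ i)) (residue d) λ j j≢d → z (+ toℕ j) λ e →
        j≢d (toℕ-≅-injective (≅-trans e (≅-sym (residue-≅ d)))))
      (per (residue-≅ d))

    -- Reduced modulo n, σ and τ become mutually inverse permutations of `Fin n`; periodicity of f
    -- hides the reduction.
    S-substitute : ∀ {f σ τ : ℤ → ℤ} → Periodic n f →
      (∀ {x y} → x ≅ y [ n ] → σ x ≅ σ y [ n ]) → (∀ {x y} → x ≅ y [ n ] → τ x ≅ τ y [ n ]) →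
      (∀ x → σ (τ x) ≅ x [ n ]) → (∀ x → τ (σ x) ≅ x [ n ]) → S n (λ x → f (σ x)) ≡ S n f
    S-substitute {f} {σ} {τ} per σ-cong τ-cong στ τσ = sym (trans
      (sum-permute (λ i → f (+ toℕ i)) (permutation σ′ τ′ (inverse σ τ σ-cong στ) (inverse τ σ τ-cong τσ)))
      (sum-cong-≗ {n} (λ i → per (residue-≅ (σ (+ toℕ i))))))
      where
      σ′ τ′ : Fin n → Fin n
      σ′ i = residue (σ (+ toℕ i))
      τ′ i = residue (τ (+ toℕ i))
      inverse : ∀ (α β : ℤ → ℤ) → (∀ {x y} → x ≅ y [ n ] → α x ≅ α y [ n ]) → (∀ x → α (β x) ≅ x [ n ]) →
        ∀ i → residue (α (+ toℕ (residue (β (+ toℕ i))))) ≡ i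
      inverse α β α-cong αβ i = toℕ-≅-injective
        (≅-trans (residue-≅ _) (≅-trans (α-cong (residue-≅ _)) (αβ (+ toℕ i))))

    S-shift : ∀ {f : ℤ → ℤ} c → Periodic n f → S n (λ x → f (x + c)) ≡ S n f
    S-shift c per = S-substitute {σ = _+ c} {τ = _- c} per
      (λ e → +-cong-≅ e ≅-refl) (λ e → +-cong-≅ e ≅-refl) (λ x → ≡⇒≅ (eq₁ x c)) (λ x → ≡⇒≅ (eq₂ x c))
      where
      eq₁ : ∀ x c → x - c + c ≡ x
      eq₁ = solve-∀
      eq₂ : ∀ x c → x + c - c ≡ x
      eq₂ = solve-∀

    S-reflect : ∀ {f : ℤ → ℤ} → Periodic n f → S n (λ x → f (- x)) ≡ S n f
    S-reflect per = S-substitute { σ = -_} { τ = -_} per neg-cong-≅ neg-cong-≅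
      (λ x → ≡⇒≅ (ℤ.neg-involutive x)) (λ x → ≡⇒≅ (ℤ.neg-involutive x))

    -- Each block of n consecutive integers starting at a multiple of n contributes only its first
    -- term.
    S-multiples : ∀ m {f : ℤ → ℤ} → (∀ x → ¬ + n ∣ᶻ x → f x ≡ 0ℤ) →
      S (m ℕ.* n) f ≡ S m (λ x → f (x * + n))
    S-multiples m {f} z = trans (S-blocks m n f) (S-cong m λ x → trans
      (sum-single (λ i → f (x * + n + + toℕ i)) (residue 0ℤ) λ j j≢0 → z _ λ n∣ →
         j≢0 (toℕ-≅-injective (≅-trans (∣⇒≅0 (∣-resp-≅ (+km-≅ (+ toℕ j) x) n∣)) (≅-sym (residue-≅ 0ℤ)))))
      (cong f (trans (cong (λ z → x * + n + + z) (trans (toℕ-fromℕ< _) (ℕ.m*n%n≡0 0 n))) (ℤ.+-identityʳ (x * + n)))))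

  -- Indicator functions

  𝟙 : ∀ {a} {A : Set a} → Dec A → ℤ
  𝟙 A? = if does A? then 1ℤ else 0ℤ

  𝟙-yes : ∀ {a} {A : Set a} (A? : Dec A) → A → 𝟙 A? ≡ 1ℤ
  𝟙-yes (yes _) _ = refl
  𝟙-yes (no ¬x) x = contradiction x ¬x

  𝟙-no : ∀ {a} {A : Set a} (A? : Dec A) → ¬ A → 𝟙 A? ≡ 0ℤ
  𝟙-no (yes x) ¬x = contradiction x ¬x
  𝟙-no (no _)  _  = refl

  𝟙-⇔ : ∀ {a b} {A : Set a} {B : Set b} (A? : Dec A) (B? : Dec B) → (A → B) → (B → A) → 𝟙 A? ≡ 𝟙 B?
  𝟙-⇔ A? (yes y) f g = 𝟙-yes A? (g y)
  𝟙-⇔ A? (no ¬y) f g = 𝟙-no A? (λ x → ¬y (f x))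

  δ : ℕ → ℤ → ℤ
  δ m x = 𝟙 (+ m ∣ᶻ? x)

  δ-yes : ∀ m {x} → + m ∣ᶻ x → δ m x ≡ 1ℤ
  δ-yes m {x} = 𝟙-yes (+ m ∣ᶻ? x)

  δ-no : ∀ m {x} → ¬ + m ∣ᶻ x → δ m x ≡ 0ℤ
  δ-no m {x} = 𝟙-no (+ m ∣ᶻ? x)

  δ-periodic : ∀ m → Periodic m (δ m)
  δ-periodic m {x} {y} e = 𝟙-⇔ (+ m ∣ᶻ? x) (+ m ∣ᶻ? y) (∣-resp-≅ e) (∣-resp-≅ (≅-sym e))

  S-δ : ∀ n .{{_ : NonZero n}} → S n (δ n) ≡ 1ℤ
  S-δ n = trans (S-single {n} 0ℤ (δ-periodic n) (λ x x≇0 → δ-no n (λ n∣x → x≇0 (∣⇒≅0 n∣x))))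
                (δ-yes n (divides 0ℤ refl))

  -- Q is an index 2 subgroup of the units modulo p that does not contain -1.
  -- The pairs of elements of Q with a given difference d are counted by N d,
  -- which is even in d and invariant under Q, hence constant on the units;
  -- summing it over all d determines the constant.
  module SkewSubgroup (p : ℕ) .{{_ : NonZero p}} (Q : ℤ → Set)
    (Q-resp : ∀ {x y} → x ≅ y [ p ] → Q x → Q y)
    (Q-1 : Q 1ℤ)
    (Q-* : ∀ {x y} → Q x → Q y → Q (x * y))
    (Q-inv : ∀ {x} → Q x → ∃ λ y → Q y × y * x ≅ 1ℤ [ p ])
    (Q-unit : ∀ {x} → Q x → ¬ + p ∣ᶻ x)
    (Q-skew : ∀ {x} → Q x → ¬ Q (- x))
    (split : ∀ x → + p ∣ᶻ x ⊎ Q x ⊎ Q (- x))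
    where

    Q? : ∀ x → Dec (Q x)
    Q? x with split x
    ... | inj₁ p∣x         = no (λ Qx → Q-unit Qx p∣x)
    ... | inj₂ (inj₁ Qx)   = yes Qx
    ... | inj₂ (inj₂ Q-x)  = no (λ Qx → Q-skew Qx Q-x)

    -- `Q?` rests on `split`, which is later supplied by a pigeonhole argument; opacity keeps `e`
    -- from unfolding to it, so that only the facts listed here are used.
    opaque
      e : ℤ → ℤ
      e x = 𝟙 (Q? x)

      e≡𝟙 : ∀ x → e x ≡ 𝟙 (Q? x)
      e≡𝟙 x = refl

      e-yes : ∀ {x} → Q x → e x ≡ 1ℤ
      e-yes {x} = 𝟙-yes (Q? x)

      e-no : ∀ {x} → ¬ Q x → e x ≡ 0ℤ
      e-no {x} = 𝟙-no (Q? x)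

      e-⇔ : ∀ {x y} → (Q x → Q y) → (Q y → Q x) → e x ≡ e y
      e-⇔ {x} {y} = 𝟙-⇔ (Q? x) (Q? y)

    ¬Q-multiple : ∀ {x} → + p ∣ᶻ x → ¬ Q x
    ¬Q-multiple p∣x Qx = Q-unit Qx p∣x

    e-periodic : Periodic p e
    e-periodic x≅y = e-⇔ (Q-resp x≅y) (Q-resp (≅-sym x≅y))

    e-scale : ∀ {u} x → Q u → e (u * x) ≡ e x
    e-scale {u} x Qu with v , Qv , vu≅1 ← Q-inv Qu =
      e-⇔ (λ Qux → Q-resp (≅-trans (≡⇒≅ (sym (ℤ.*-assoc v u x)))
                          (≅-trans (*-congʳ-≅ x vu≅1) (≡⇒≅ (ℤ.*-identityˡ x)))) (Q-* Qv Qux))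
          (Q-* Qu)

    e-partition : ∀ x → e x + e (- x) + δ p x ≡ 1ℤ
    e-partition x with split x
    ... | inj₁ p∣x        rewrite e-no (¬Q-multiple p∣x) | e-no (¬Q-multiple (∣.∣m⇒∣-m p∣x)) | δ-yes p p∣x = refl
    ... | inj₂ (inj₁ Qx)  rewrite e-yes Qx | e-no (Q-skew Qx) | δ-no p (Q-unit Qx) = refl
    ... | inj₂ (inj₂ Q-x) rewrite e-no (λ Qx → Q-skew Qx Q-x) | e-yes Q-x
                                | δ-no p (λ p∣x → Q-unit Q-x (∣.∣m⇒∣-m p∣x)) = refl

    e-idem : ∀ x → e x * e x ≡ e x
    e-idem x with Q? x
    ... | yes Qx = trans (cong (_* e x) (e-yes Qx)) (ℤ.*-identityˡ (e x))
    ... | no ¬Qx = trans (cong (_* e x) (e-no ¬Qx)) (sym (e-no ¬Qx))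

    h : ℤ
    h = S p e

    N : ℤ → ℤ
    N d = S p (λ x → e x * e (x - d))

    a : ℤ
    a = N 1ℤ

    S-e-reflect : S p (λ x → e (- x)) ≡ h
    S-e-reflect = S-reflect e-periodic

    -- The partition of the residues into Q, -Q and 0, summed over a full period.
    h-double : h + h + 1ℤ ≡ + p
    h-double = begin
      h + h + 1ℤ
        ≡⟨ cong₂ (λ y z → h + y + z) S-e-reflect (S-δ p) ⟨
      h + S p (λ x → e (- x)) + S p (δ p)
        ≡⟨ cong (λ z → z + S p (δ p)) (S-+ p e (λ x → e (- x))) ⟨
      S p (λ x → e x + e (- x)) + S p (δ p)
        ≡⟨ S-+ p (λ x → e x + e (- x)) (δ p) ⟨
      S p (λ x → e x + e (- x) + δ p x)
        ≡⟨ S-cong p e-partition ⟩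
      S p (λ _ → 1ℤ)
        ≡⟨ trans (S-const p 1ℤ) (ℤ.*-identityʳ (+ p)) ⟩
      + p ∎
      where open ≡-Reasoning

    -- Needed to cancel h in `h≡2a+1`. If h were 0, then p would be 1 and would divide the element 1
    -- of Q.
    h≢0 : h ≢ 0ℤ
    h≢0 h≡0 = Q-unit Q-1 (subst (_∣ᶻ 1ℤ) (trans (cong (λ z → z + z + 1ℤ) (sym h≡0)) h-double) ∣.∣-refl)

    N-0 : ∀ {d} → + p ∣ᶻ d → N d ≡ h
    N-0 {d} p∣d = S-cong p λ x → trans
      (cong (e x *_) (e-periodic (≅-trans (+-congˡ-≅ x (neg-cong-≅ (∣⇒≅0 p∣d))) (≡⇒≅ (ℤ.+-identityʳ x)))))
      (e-idem x)

    -- The shift of x by -d exchanges the two factors.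
    N-even : ∀ d → N (- d) ≡ N d
    N-even d = begin
      S p (λ x → e x * e (x - - d))
        ≡⟨ S-shift (- d) (λ x≅y → cong₂ _*_ (e-periodic x≅y) (e-periodic (+-cong-≅ x≅y ≅-refl))) ⟨
      S p (λ x → e (x - d) * e (x - d - - d))
        ≡⟨ S-cong p (λ x → trans (cong (λ z → e (x - d) * e z) (cancel x d)) (ℤ.*-comm (e (x - d)) (e x))) ⟩
      N d ∎
      where
      open ≡-Reasoning
      cancel : ∀ x d → x - d - - d ≡ x
      cancel = solve-∀

    -- Substituting u x for x puts u into both arguments of `e`, where `e-scale` removes it.
    N-scale : ∀ {u} d → Q u → N (u * d) ≡ N d
    N-scale {u} d Qu with v , Qv , vu≅1 ← Q-inv Qu = begin
      S p (λ x → e x * e (x - u * d))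
        ≡⟨ S-substitute {σ = u *_} {τ = v *_}
             (λ x≅y → cong₂ _*_ (e-periodic x≅y) (e-periodic (+-cong-≅ x≅y ≅-refl)))
             (*-congˡ-≅ u) (*-congˡ-≅ v)
             (λ x → ≅-trans (≡⇒≅ (swap u v x)) (unit x)) (λ x → ≅-trans (≡⇒≅ (sym (ℤ.*-assoc v u x))) (unit x)) ⟨
      S p (λ x → e (u * x) * e (u * x - u * d))
        ≡⟨ S-cong p (λ x → cong₂ _*_ (e-scale x Qu) (trans (cong e (distrib u x d)) (e-scale (x - d) Qu))) ⟩
      N d ∎
      where
      open ≡-Reasoning
      swap : ∀ u v x → u * (v * x) ≡ v * u * x
      swap = solve-∀
      distrib : ∀ u x d → u * x - u * d ≡ u * (x - d)
      distrib = solve-∀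
      unit : ∀ x → v * u * x ≅ x [ p ]
      unit x = ≅-trans (*-congʳ-≅ x vu≅1) (≡⇒≅ (ℤ.*-identityˡ x))

    N-Q : ∀ {d} → Q d → N d ≡ a
    N-Q {d} Qd = trans (cong N (sym (ℤ.*-identityʳ d))) (N-scale 1ℤ Qd)

    autocorrelation : ∀ d → N d ≡ a * (e d + e (- d)) + h * δ p d
    autocorrelation d with split d
    ... | inj₁ p∣d        rewrite e-no (¬Q-multiple p∣d) | e-no (¬Q-multiple (∣.∣m⇒∣-m p∣d)) | δ-yes p p∣d =
      trans (N-0 p∣d) (simp a h)
      where
      simp : ∀ a h → h ≡ a * 0ℤ + h * 1ℤ
      simp = solve-∀
    ... | inj₂ (inj₁ Qd)  rewrite e-yes Qd | e-no (Q-skew Qd) | δ-no p (Q-unit Qd) = trans (N-Q Qd) (simp a h)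
      where
      simp : ∀ a h → a ≡ a * 1ℤ + h * 0ℤ
      simp = solve-∀
    ... | inj₂ (inj₂ Q-d) rewrite e-no (λ Qd → Q-skew Qd Q-d) | e-yes Q-d | δ-no p (λ p∣d → Q-unit Q-d (∣.∣m⇒∣-m p∣d)) =
      trans (sym (N-even d)) (trans (N-Q Q-d) (simp a h))
      where
      simp : ∀ a h → a ≡ a * 1ℤ + h * 0ℤ
      simp = solve-∀

    -- Every pair of elements of Q has exactly one difference, so the counts add up to the number of
    -- all pairs.
    S-N : S p N ≡ h * h
    S-N = begin
      S p (λ d → S p (λ x → e x * e (x - d)))
        ≡⟨ S-comm p p (λ d x → e x * e (x - d)) ⟩
      S p (λ x → S p (λ d → e x * e (x - d)))
        ≡⟨ S-cong p (λ x → trans (S-* p (e x) (λ d → e (x - d))) (cong (e x *_) (reflected x))) ⟩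
      S p (λ x → e x * h)
        ≡⟨ S-cong p (λ x → ℤ.*-comm (e x) h) ⟩
      S p (λ x → h * e x)
        ≡⟨ S-* p h e ⟩
      h * h ∎
      where
      open ≡-Reasoning
      involutive : ∀ x d → x - (x - d) ≡ d
      involutive = solve-∀
      reflected : ∀ x → S p (λ d → e (x - d)) ≡ h
      reflected x = S-substitute {σ = λ d → x - d} {τ = λ d → x - d} e-periodic
        (λ eq → +-congˡ-≅ x (neg-cong-≅ eq)) (λ eq → +-congˡ-≅ x (neg-cong-≅ eq))
        (λ d → ≡⇒≅ (involutive x d)) (λ d → ≡⇒≅ (involutive x d))

    -- Summing `autocorrelation` over d evaluates `S-N` a second time, as 2ah + h; one factor h
    -- cancels.
    h≡2a+1 : h ≡ a + a + 1ℤ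
    h≡2a+1 = ℤ.*-cancelˡ-≡ h h (a + a + 1ℤ) {{ℤ.≢-nonZero h≢0}} (begin
      h * h
        ≡⟨ S-N ⟨
      S p N
        ≡⟨ S-cong p autocorrelation ⟩
      S p (λ d → a * (e d + e (- d)) + h * δ p d)
        ≡⟨ S-+ p (λ d → a * (e d + e (- d))) (λ d → h * δ p d) ⟩
      S p (λ d → a * (e d + e (- d))) + S p (λ d → h * δ p d)
        ≡⟨ cong₂ _+_ (trans (S-* p a (λ d → e d + e (- d))) (cong (a *_) (S-+ p e (λ d → e (- d)))))
                     (S-* p h (δ p)) ⟩
      a * (h + S p (λ d → e (- d))) + h * S p (δ p)
        ≡⟨ cong₂ (λ y z → a * (h + y) + h * z) S-e-reflect (S-δ p) ⟩
      a * (h + h) + h * 1ℤ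
        ≡⟨ regroup a h ⟩
      h * (a + a + 1ℤ) ∎)
      where
      open ≡-Reasoning
      regroup : ∀ a h → a * (h + h) + h * 1ℤ ≡ h * (a + a + 1ℤ)
      regroup = solve-∀

    -- The partition at x - d expresses e (d - x) through e (x - d), so the sum becomes h - e d - N
    -- d. This is h - 1 - a = a on Q, h - a = a + 1 on -Q, and h - h = 0 at multiples of p.
    selfconvolution : ∀ d → S p (λ x → e x * e (d - x)) ≡ a * e d + (a + 1ℤ) * e (- d)
    selfconvolution d = begin
      S p (λ x → e x * e (d - x))
        ≡⟨ S-cong p pointwise ⟩
      S p (λ x → e x + - (e x * δ p (x - d) + e x * e (x - d)))
        ≡⟨ S-+ p e (λ x → - (e x * δ p (x - d) + e x * e (x - d))) ⟩
      h + S p (λ x → - (e x * δ p (x - d) + e x * e (x - d)))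
        ≡⟨ cong₂ _+_ {h} refl (trans (S-neg p (λ x → e x * δ p (x - d) + e x * e (x - d)))
             (cong -_ (S-+ p (λ x → e x * δ p (x - d)) (λ x → e x * e (x - d))))) ⟩
      h - (S p (λ x → e x * δ p (x - d)) + N d)
        ≡⟨ cong₂ (λ y z → h - (y + z)) diagonal (autocorrelation d) ⟩
      h - (e d + (a * (e d + e (- d)) + h * δ p d))
        ≡⟨ collect (e d) (e (- d)) (δ p d) a h ⟩
      h * (1ℤ - δ p d) - (e d + a * (e d + e (- d)))
        ≡⟨ cong₂ (λ y z → y * (z - δ p d) - (e d + a * (e d + e (- d)))) h≡2a+1 (sym (e-partition d)) ⟩
      (a + a + 1ℤ) * (e d + e (- d) + δ p d - δ p d) - (e d + a * (e d + e (- d)))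
        ≡⟨ finish (e d) (e (- d)) (δ p d) a ⟩
      a * e d + (a + 1ℤ) * e (- d) ∎
      where
      open ≡-Reasoning
      collect : ∀ e e′ D a h → h - (e + (a * (e + e′) + h * D)) ≡ h * (1ℤ - D) - (e + a * (e + e′))
      collect = solve-∀
      finish : ∀ e e′ D a → (a + a + 1ℤ) * (e + e′ + D - D) - (e + a * (e + e′)) ≡ a * e + (a + 1ℤ) * e′
      finish = solve-∀
      flip : ∀ x d → d - x ≡ - (x - d)
      flip = solve-∀
      isolate : ∀ e e′ D → e′ ≡ e + e′ + D - (D + e)
      isolate = solve-∀
      expand : ∀ c D e → c * (1ℤ - (D + e)) ≡ c + - (c * D + c * e)
      expand = solve-∀
      pointwise : ∀ x → e x * e (d - x) ≡ e x + - (e x * δ p (x - d) + e x * e (x - d))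
      pointwise x = begin
        e x * e (d - x)
          ≡⟨ cong (λ z → e x * e z) (flip x d) ⟩
        e x * e (- (x - d))
          ≡⟨ cong (e x *_) (isolate (e (x - d)) (e (- (x - d))) (δ p (x - d))) ⟩
        e x * (e (x - d) + e (- (x - d)) + δ p (x - d) - (δ p (x - d) + e (x - d)))
          ≡⟨ cong (λ z → e x * (z - (δ p (x - d) + e (x - d)))) (e-partition (x - d)) ⟩
        e x * (1ℤ - (δ p (x - d) + e (x - d)))
          ≡⟨ expand (e x) (δ p (x - d)) (e (x - d)) ⟩
        e x + - (e x * δ p (x - d) + e x * e (x - d)) ∎
      diagonal : S p (λ x → e x * δ p (x - d)) ≡ e d
      diagonal = trans
        (S-single d (λ x≅y → cong₂ _*_ (e-periodic x≅y) (δ-periodic p (+-cong-≅ x≅y ≅-refl)))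
          (λ x x≇d → trans (cong (e x *_) (δ-no p (λ p∣ → x≇d ⌊ p∣ ⌋))) (ℤ.*-zeroʳ (e x))))
        (trans (cong (e d *_) (δ-yes p (⌈_⌉ (≅-refl {p} {d})))) (ℤ.*-identityʳ (e d)))

  -- Polynomials modulo xⁿ - 1

  -- delay m u is the coefficient sequence of x ^ m times the series u.
  delay : ℕ → (ℕ → ℤ) → ℕ → ℤ
  delay zero    u k       = u k
  delay (suc m) u zero    = 0ℤ
  delay (suc m) u (suc k) = delay m u k

  delay-cong : ∀ m {u v : ℕ → ℤ} → (∀ k → u k ≡ v k) → ∀ k → delay m u k ≡ delay m v k
  delay-cong zero    eq k       = eq k
  delay-cong (suc m) eq zero    = refl
  delay-cong (suc m) eq (suc k) = delay-cong m eq k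

  delay-0 : ∀ m k → delay m (λ _ → 0ℤ) k ≡ 0ℤ
  delay-0 zero    k       = refl
  delay-0 (suc m) zero    = refl
  delay-0 (suc m) (suc k) = delay-0 m k

  delay-< : ∀ m u {k} → k ℕ.< m → delay m u k ≡ 0ℤ
  delay-< (suc m) u {zero}  _         = refl
  delay-< (suc m) u {suc k} (s≤s k<m) = delay-< m u k<m

  delay-+ : ∀ m u k → delay m u (m ℕ.+ k) ≡ u k
  delay-+ zero    u k = refl
  delay-+ (suc m) u k = delay-+ m u k

  -- As power series the hypotheses say u = c v + x w; the conclusion is this relation times x^m.
  delay-linear : ∀ m c (u v w : ℕ → ℤ) → u 0 ≡ c * v 0 → (∀ k → u (suc k) ≡ c * v (suc k) + w k) →
    ∀ k → delay m u k ≡ c * delay m v k + delay (suc m) w k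
  delay-linear zero    c u v w eq₀ eq zero    = trans eq₀ (sym (ℤ.+-identityʳ (c * v 0)))
  delay-linear zero    c u v w eq₀ eq (suc k) = eq k
  delay-linear (suc m) c u v w eq₀ eq zero    = sym (cong (_+ 0ℤ) (ℤ.*-zeroʳ c))
  delay-linear (suc m) c u v w eq₀ eq (suc k) = delay-linear m c u v w eq₀ eq k

  -- The series D with coefficients `δ n` is 1/(1 - x^n), so x^n D and D differ only in the constant
  -- term; hence the restriction to positive exponents.
  δ-delay : ∀ n k → delay n (λ j → δ n (+ j)) (suc k) ≡ δ n (+ suc k)
  δ-delay n k with suc k ℕ.<? n
  ... | yes k<n = trans (delay-< n (λ j → δ n (+ j)) k<n) (sym (δ-no n {+ suc k} λ n∣k → ℕ.<⇒≱ k<n (ℕ.∣⇒≤ (∣.∣⇒∣ᵤ n∣k))))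
  ... | no k≮n with j , eq ← ℕ.m≤n⇒∃[o]m+o≡n (ℕ.≮⇒≥ k≮n) =
    subst (λ i → delay n (λ j → δ n (+ j)) i ≡ δ n (+ i)) eq (trans (delay-+ n _ j)
      (δ-periodic n (≅-sym (≅-trans (≡⇒≅ (cong (_+ + j) (sym (ℤ.*-identityˡ (+ n))))) (+km-≅ (+ j) 1ℤ)))))

  module CyclicCoefficients (l n : ℕ) .{{_ : NonZero n}} where

    open Polynomial (𝔽 l)

    -- fold f d is the sum of the coefficients of f at the exponents congruent to d modulo n.
    fold : Poly → ℤ → ℤ
    fold []      d = 0ℤ
    fold (a ∷ f) d = a * δ n d + fold f (d - 1ℤ)

    fold-periodic : ∀ f → Periodic n (fold f)
    fold-periodic []      x≅y = refl
    fold-periodic (a ∷ f) x≅y = cong₂ (λ y z → a * y + z) (δ-periodic n x≅y) (fold-periodic f (+-cong-≅ x≅y ≅-refl))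

    fold-+ : ∀ f g d → fold (f +ᴾ g) d ≡ fold f d + fold g d
    fold-+ []      g       d = sym (ℤ.+-identityˡ (fold g d))
    fold-+ (a ∷ f) []      d = sym (ℤ.+-identityʳ (fold (a ∷ f) d))
    fold-+ (a ∷ f) (b ∷ g) d = trans (cong₂ _+_ {(a + b) * δ n d} refl (fold-+ f g (d - 1ℤ))) (eq a b (δ n d) _ _)
      where
      eq : ∀ a b D x y → (a + b) * D + (x + y) ≡ a * D + x + (b * D + y)
      eq = solve-∀

    fold-map : ∀ (h : ℤ → ℤ) c → (∀ x → h x ≡ c * x) → ∀ f d → fold (map h f) d ≡ c * fold f d
    fold-map h c eq []      d = sym (ℤ.*-zeroʳ c)
    fold-map h c eq (a ∷ f) d = trans (cong₂ (λ y z → y * δ n d + z) (eq a) (fold-map h c eq f (d - 1ℤ)))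
                                  (factor c a (δ n d) _)
      where
      factor : ∀ c a D x → c * a * D + c * x ≡ c * (a * D + x)
      factor = solve-∀

    fold-X^ : ∀ k d → fold (X^ k) d ≡ δ n (d - + k)
    fold-X^ zero    d = trans (eq (δ n d)) (cong (δ n) (sym (ℤ.+-identityʳ d)))
      where
      eq : ∀ D → 1ℤ * D + 0ℤ ≡ D
      eq = solve-∀
    fold-X^ (suc k) d = trans (eq (δ n d) _) (trans (fold-X^ k (d - 1ℤ)) (cong (δ n) (assoc d (+ k))))
      where
      eq : ∀ D x → 0ℤ * D + x ≡ x
      eq = solve-∀
      assoc : ∀ d k → d - 1ℤ - k ≡ d - (1ℤ + k)
      assoc = solve-∀

    fold-constant* : ∀ c f d → fold (constant c *ᴾ f) d ≡ c * fold f d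
    fold-constant* c f d = trans (fold-+ (map (c *_) f) (0ℤ ∷ []) d)
      (trans (cong (_+ (0ℤ * δ n d + 0ℤ)) (fold-map (c *_) c (λ _ → refl) f d)) (eq (c * fold f d) (δ n d)))
      where
      eq : ∀ x D → x + (0ℤ * D + 0ℤ) ≡ x
      eq = solve-∀

    -- Induction on f through a ∷ f = a + x f: the constant term contributes only at x = 0
    -- (`diagonal`), and the factor x is absorbed by shifting the summation variable (`shifted`).
    fold-* : ∀ f g d → fold (f *ᴾ g) d ≡ S n (λ x → fold f x * fold g (d - x))
    fold-* []      g d = sym (S-0 n (λ x → refl))
    fold-* (a ∷ f) g d = begin
      fold (map (a *_) g +ᴾ (0ℤ ∷ f *ᴾ g)) d
        ≡⟨ fold-+ (map (a *_) g) (0ℤ ∷ f *ᴾ g) d ⟩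
      fold (map (a *_) g) d + (0ℤ * δ n d + fold (f *ᴾ g) (d - 1ℤ))
        ≡⟨ cong₂ (λ y z → y + (0ℤ * δ n d + z)) (fold-map (a *_) a (λ _ → refl) g d) (fold-* f g (d - 1ℤ)) ⟩
      a * fold g d + (0ℤ * δ n d + S n (λ x → fold f x * fold g (d - 1ℤ - x)))
        ≡⟨ cong₂ (λ y z → a * y + (0ℤ * δ n d + z)) (sym diagonal) (sym shifted) ⟩
      a * S n (λ x → δ n x * fold g (d - x)) + (0ℤ * δ n d + S n (λ x → fold f (x - 1ℤ) * fold g (d - x)))
        ≡⟨ cong₂ (λ y z → y + z) (sym (S-* n a (λ x → δ n x * fold g (d - x)))) (drop (δ n d) _) ⟩
      S n (λ x → a * (δ n x * fold g (d - x))) + S n (λ x → fold f (x - 1ℤ) * fold g (d - x))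
        ≡⟨ S-+ n (λ x → a * (δ n x * fold g (d - x))) (λ x → fold f (x - 1ℤ) * fold g (d - x)) ⟨
      S n (λ x → a * (δ n x * fold g (d - x)) + fold f (x - 1ℤ) * fold g (d - x))
        ≡⟨ S-cong n (λ x → distrib a (δ n x) (fold g (d - x)) (fold f (x - 1ℤ))) ⟩
      S n (λ x → fold (a ∷ f) x * fold g (d - x)) ∎
      where
      open ≡-Reasoning
      drop : ∀ D x → 0ℤ * D + x ≡ x
      drop = solve-∀
      distrib : ∀ a D G F → a * (D * G) + F * G ≡ (a * D + F) * G
      distrib = solve-∀
      cancel : ∀ d x → d - x ≡ d - 1ℤ - (x - 1ℤ)
      cancel = solve-∀
      minus : ∀ {x y} z → x ≅ y [ n ] → z - x ≅ z - y [ n ]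
      minus z x≅y = +-congˡ-≅ z (neg-cong-≅ x≅y)
      diagonal : S n (λ x → δ n x * fold g (d - x)) ≡ fold g d
      diagonal = begin
        S n (λ x → δ n x * fold g (d - x))
          ≡⟨ S-single 0ℤ (λ x≅y → cong₂ _*_ (δ-periodic n x≅y) (fold-periodic g (minus d x≅y)))
               (λ x x≇0 → cong (_* fold g (d - x)) (δ-no n (λ n∣x → x≇0 (∣⇒≅0 n∣x)))) ⟩
        δ n 0ℤ * fold g (d - 0ℤ)
          ≡⟨ cong₂ (λ y z → y * fold g z) (δ-yes n (divides 0ℤ refl)) (ℤ.+-identityʳ d) ⟩
        1ℤ * fold g d
          ≡⟨ ℤ.*-identityˡ (fold g d) ⟩
        fold g d ∎
      shifted : S n (λ x → fold f (x - 1ℤ) * fold g (d - x)) ≡ S n (λ x → fold f x * fold g (d - 1ℤ - x))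
      shifted = trans (S-cong n (λ x → cong (λ z → fold f (x - 1ℤ) * fold g z) (cancel d x)))
        (S-shift (- 1ℤ) (λ x≅y → cong₂ _*_ (fold-periodic f x≅y) (fold-periodic g (minus (d - 1ℤ) x≅y))))

    fold-∑ : ∀ {m k} (f : Fin m → Fin k) {P : Fin k → Set} (P? : ∀ α → Dec (P α)) (F : Fin k → Poly) d →
      fold (foldr _+ᴾ_ [] (map F (filter P? (tabulate f)))) d ≡ sum (λ i → 𝟙 (P? (f i)) * fold (F (f i)) d)
    fold-∑ {zero}  f P? F d = refl
    fold-∑ {suc m} f P? F d with P? (f Fin.zero)
    ... | yes _ = trans (fold-+ (F (f Fin.zero)) _ d)
      (cong₂ _+_ (sym (ℤ.*-identityˡ (fold (F (f Fin.zero)) d))) (fold-∑ (f ∘ Fin.suc) P? F d))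
    ... | no _  = trans (fold-∑ (f ∘ Fin.suc) P? F d) (sym (ℤ.+-identityˡ _))

    fold-subset : ∀ {P : Fin n → Set} (P? : ∀ α → Dec (P α)) d →
      fold (foldr _+ᴾ_ [] (map (λ α → X^ (toℕ α)) (filter P? (allFin n)))) d ≡ 𝟙 (P? (residue d))
    fold-subset P? d = trans (fold-∑ id P? (λ α → X^ (toℕ α)) d) (trans
      (sum-single _ (residue d) (λ j j≢d → trans (cong (𝟙 (P? j) *_) (trans (fold-X^ (toℕ j) d)
          (δ-no n (λ n∣ → j≢d (sym (toℕ-≅-injective (≅-trans (residue-≅ d) ⌊ n∣ ⌋)))))))
        (ℤ.*-zeroʳ (𝟙 (P? j)))))
      (trans (cong (𝟙 (P? (residue d)) *_) (trans (fold-X^ (toℕ (residue d)) d)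
          (δ-yes n (⌈_⌉ (≅-sym (residue-≅ d))))))
        (ℤ.*-identityʳ (𝟙 (P? (residue d))))))

    coeff-+ : ∀ f g k → coeff (f +ᴾ g) k ≡ coeff f k + coeff g k
    coeff-+ []      g       k       = sym (ℤ.+-identityˡ _)
    coeff-+ (a ∷ f) []      k       = sym (ℤ.+-identityʳ _)
    coeff-+ (a ∷ f) (b ∷ g) zero    = refl
    coeff-+ (a ∷ f) (b ∷ g) (suc k) = coeff-+ f g k

    coeff-map : ∀ c f k → coeff (map (c *_) f) k ≡ c * coeff f k
    coeff-map c []      k       = sym (ℤ.*-zeroʳ c)
    coeff-map c (a ∷ f) zero    = refl
    coeff-map c (a ∷ f) (suc k) = coeff-map c f k

    coeff-X^ : ∀ m k → coeff (X^ m) k ≡ delay m (coeff (constant 1ℤ)) k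
    coeff-X^ zero    k       = refl
    coeff-X^ (suc m) zero    = refl
    coeff-X^ (suc m) (suc k) = coeff-X^ m k

    modulus : Poly
    modulus = (X^ n) +ᴾ constant (- 1ℤ)

    coeff-modulus : ∀ k → coeff modulus k ≡ delay n (coeff (constant 1ℤ)) k - coeff (constant 1ℤ) k
    coeff-modulus k = trans (coeff-+ (X^ n) (constant (- 1ℤ)) k) (cong₂ _+_ (coeff-X^ n k) (neg k))
      where
      neg : ∀ k → coeff (constant (- 1ℤ)) k ≡ - coeff (constant 1ℤ) k
      neg zero    = refl
      neg (suc k) = refl

    coeff-*-modulus : ∀ h k → coeff (h *ᴾ modulus) k ≡ delay n (coeff h) k - coeff h k
    coeff-*-modulus []      k = sym (cong (_- 0ℤ) (delay-0 n k))
    coeff-*-modulus (a ∷ h) k = begin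
      coeff (map (a *_) modulus +ᴾ (0ℤ ∷ h *ᴾ modulus)) k
        ≡⟨ coeff-+ (map (a *_) modulus) (0ℤ ∷ h *ᴾ modulus) k ⟩
      coeff (map (a *_) modulus) k + coeff (0ℤ ∷ h *ᴾ modulus) k
        ≡⟨ cong (_+ coeff (0ℤ ∷ h *ᴾ modulus) k) (trans (coeff-map a modulus k) (cong (a *_) (coeff-modulus k))) ⟩
      a * (delay n c₁ k - c₁ k) + coeff (0ℤ ∷ h *ᴾ modulus) k
        ≡⟨ split k ⟩
      delay n (coeff (a ∷ h)) k - coeff (a ∷ h) k ∎
      where
      open ≡-Reasoning
      c₁ : ℕ → ℤ
      c₁ = coeff (constant 1ℤ)
      linear : ∀ k → delay n (coeff (a ∷ h)) k ≡ a * delay n c₁ k + delay (suc n) (coeff h) k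
      linear = delay-linear n a (coeff (a ∷ h)) c₁ (coeff h) (sym (ℤ.*-identityʳ a))
        (λ k → sym (trans (cong (_+ coeff h k) (ℤ.*-zeroʳ a)) (ℤ.+-identityˡ _)))
      eq₀ : ∀ a x → a * (x - 1ℤ) + 0ℤ ≡ a * x + 0ℤ - a
      eq₀ = solve-∀
      eq₁ : ∀ a x y z → a * (x - 0ℤ) + (y - z) ≡ a * x + y - z
      eq₁ = solve-∀
      split : ∀ k → a * (delay n c₁ k - c₁ k) + coeff (0ℤ ∷ h *ᴾ modulus) k ≡
                    delay n (coeff (a ∷ h)) k - coeff (a ∷ h) k
      split zero    = trans (eq₀ a (delay n c₁ zero)) (cong (_- a) (sym (linear zero)))
      split (suc k) = trans (cong₂ _+_ {a * (delay n c₁ (suc k) - 0ℤ)} refl (coeff-*-modulus h k))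
        (trans (eq₁ a (delay n c₁ (suc k)) _ _) (cong (_- coeff h k) (sym (linear (suc k)))))

    -- The coefficients of the power series f / (x ^ n - 1).
    series : Poly → ℕ → ℤ
    series []      k       = 0ℤ
    series (a ∷ f) zero    = - a * δ n 0ℤ
    series (a ∷ f) (suc k) = - a * δ n (+ suc k) + series f k

    -- The leading coefficient a contributes -a/(1 - x^n). Multiplied by x^n - 1 this gives a at
    -- exponent 0 and cancels at all others by `δ-delay`; the tail is covered by induction.
    series-divides : ∀ f k → delay n (series f) k - series f k ≡ coeff f k
    series-divides []      k = cong (_- 0ℤ) (delay-0 n k)
    series-divides (a ∷ f) k = trans (cong (_- series (a ∷ f) k) (linear k)) (split k)
      where
      D : ℕ → ℤ
      D j = δ n (+ j)
      linear : ∀ k → delay n (series (a ∷ f)) k ≡ - a * delay n D k + delay (suc n) (series f) k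
      linear = delay-linear n (- a) (series (a ∷ f)) D (series f) refl (λ _ → refl)
      eq₀ : ∀ a → - a * 0ℤ + 0ℤ - - a * 1ℤ ≡ a
      eq₀ = solve-∀
      eq₁ : ∀ x y z → x + y - (x + z) ≡ y - z
      eq₁ = solve-∀
      split : ∀ k → - a * delay n D k + delay (suc n) (series f) k - series (a ∷ f) k ≡ coeff (a ∷ f) k
      split zero    rewrite delay-< n D (ℕ.>-nonZero⁻¹ n) | δ-yes n {0ℤ} (divides 0ℤ refl) = eq₀ a
      split (suc k) rewrite δ-delay n k = trans (eq₁ (- a * D (suc k)) _ _) (series-divides f k)

    -- The k-th coefficient collects, with a minus sign, the coefficients of f at exponents up to k
    -- congruent to k. Once k is beyond the length of f, none is left out.
    series-fold : ∀ f {k} → length f ℕ.≤ k → series f k ≡ - fold f (+ k)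
    series-fold []      _ = refl
    series-fold (a ∷ f) {suc k} (s≤s le) =
      trans (cong₂ _+_ { - a * δ n (+ suc k)} refl (series-fold f le)) (eq a (δ n (+ suc k)) (fold f (+ k)))
      where
      eq : ∀ a D x → - a * D + - x ≡ - (a * D + x)
      eq = solve-∀

    coeff-applyUpTo : ∀ (u : ℕ → ℤ) m k → (m ℕ.≤ k → u k ≡ 0ℤ) → coeff (applyUpTo u m) k ≡ u k
    coeff-applyUpTo u zero    k       z = sym (z z≤n)
    coeff-applyUpTo u (suc m) zero    z = refl
    coeff-applyUpTo u (suc m) (suc k) z = coeff-applyUpTo (u ∘ suc) m k (λ le → z (s≤s le))

    -- For the difference r of f and g all folds vanish, so by `series-fold` the power series r/(x^n
    -- - 1) stops at the length of r. The quotient is therefore a polynomial, and truncating the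
    -- series loses nothing.
    fold-injective : ∀ f g → (∀ d → fold f d ≡ fold g d) → ∃ λ h → (f +ᴾ map -_ g) ≈ᴾ h *ᴾ modulus
    fold-injective f g eq = h , λ k → ⌈_⌉ (≡⇒≅ (sym (begin
      coeff (h *ᴾ modulus) k              ≡⟨ coeff-*-modulus h k ⟩
      delay n (coeff h) k - coeff h k  ≡⟨ cong₂ _-_ (delay-cong n coeff-h k) (coeff-h k) ⟩
      delay n (series r) k - series r k ≡⟨ series-divides r k ⟩
      coeff r k                        ∎)))
      where
      open ≡-Reasoning
      r h : Poly
      r = f +ᴾ map -_ g
      h = applyUpTo (series r) (length r)
      r-vanishes : ∀ d → fold r d ≡ 0ℤ
      r-vanishes d = begin
        fold r d                   ≡⟨ fold-+ f (map -_ g) d ⟩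
        fold f d + fold (map -_ g) d
          ≡⟨ cong₂ _+_ (eq d) (trans (fold-map -_ (- 1ℤ) (λ x → sym (ℤ.-1*i≡-i x)) g d) (ℤ.-1*i≡-i (fold g d))) ⟩
        fold g d - fold g d        ≡⟨ ℤ.+-inverseʳ (fold g d) ⟩
        0ℤ ∎
      coeff-h : ∀ k → coeff h k ≡ series r k
      coeff-h k = coeff-applyUpTo (series r) (length r) k
        (λ le → trans (series-fold r le) (cong -_ (r-vanishes (+ k))))

  -- Units modulo a prime power

  length-filter-sum : ∀ {P : ℕ → Set} (P? : ∀ k → Dec (P k)) (f : ℕ → ℕ) n →
    + length (filter P? (applyUpTo f n)) ≡ sum {n} (λ i → 𝟙 (P? (f (toℕ i))))
  length-filter-sum P? f zero    = refl
  length-filter-sum P? f (suc n) with P? (f 0)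
  ... | yes _ = cong (λ z → 1ℤ + z) (length-filter-sum P? (f ∘ suc) n)
  ... | no _  = trans (length-filter-sum P? (f ∘ suc) n) (sym (ℤ.+-identityˡ _))

  module _ {p : ℕ} (p-prime : Prime p) where

    private instance
      p≢0 : NonZero p
      p≢0 = prime⇒nonZero p-prime

    prime∤1 : ¬ p ℕ.∣ 1
    prime∤1 p∣1 = ℕ.nonTrivial⇒≢1 {{prime⇒nonTrivial p-prime}} (ℕ.∣1⇒≡1 p∣1)

    ∣-^ : ∀ m → p ℕ.∣ p ^ suc m
    ∣-^ m = ℕ.m∣m*n (p ^ m)

    -- A common divisor d of p^(m+1) and k is coprime to p, because p does not divide k; so d
    -- already divides p^m.
    ∤⇒coprime-^ : ∀ m {k} → ¬ p ℕ.∣ k → Coprime (p ^ m) k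
    ∤⇒coprime-^ zero    p∤k (d∣1 , _) = ℕ.∣1⇒≡1 d∣1
    ∤⇒coprime-^ (suc m) {k} p∤k {d} (d∣p^ , d∣k) = ∤⇒coprime-^ m p∤k (coprime-divisor d⊥p d∣p^ , d∣k)
      where
      d⊥p : Coprime d p
      d⊥p {c} (c∣d , c∣p) with prime⇒irreducible p-prime c∣p
      ... | inj₁ c≡1  = c≡1
      ... | inj₂ refl = contradiction (ℕ.∣-trans c∣d d∣k) p∤k

    coprime-^⇒∤ : ∀ m {k} → Coprime (p ^ suc m) k → ¬ p ℕ.∣ k
    coprime-^⇒∤ m p^⊥k p∣k = prime∤1 (ℕ.∣-reflexive (p^⊥k (∣-^ m , p∣k)))

    -- Coprimality to p^(m+1) depends only on the residue modulo p, so the count is p^m times that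
    -- of one period.
    φ-prime-power : ∀ m → + φ (p ^ suc m) ≡ + (p ^ m) * (+ p - 1ℤ)
    φ-prime-power m = begin
      + φ (p ^ suc m)
        ≡⟨ length-filter-sum (coprime? (p ^ suc m)) id (p ^ suc m) ⟩
      sum {p ^ suc m} (λ i → 𝟙 (coprime? (p ^ suc m) (toℕ i)))
        ≡⟨ sum-cong-≗ {p ^ suc m} (λ i → unit (toℕ i)) ⟩
      S (p ^ suc m) f
        ≡⟨ cong (λ z → S z f) (ℕ.*-comm p (p ^ m)) ⟩
      S (p ^ m ℕ.* p) f
        ≡⟨ S-periodic (p ^ m) p {f} (λ x≅y → cong (λ z → 1ℤ - z) (δ-periodic p x≅y)) ⟩
      + (p ^ m) * S p f
        ≡⟨ cong (+ (p ^ m) *_) (trans (S-+ p (λ _ → 1ℤ) (λ x → - δ p x)) (cong₂ _+_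
             (trans (S-const p 1ℤ) (ℤ.*-identityʳ (+ p))) (trans (S-neg p (δ p)) (cong -_ (S-δ p))))) ⟩
      + (p ^ m) * (+ p - 1ℤ) ∎
      where
      open ≡-Reasoning
      f : ℤ → ℤ
      f x = 1ℤ - δ p x
      unit : ∀ k → 𝟙 (coprime? (p ^ suc m) k) ≡ f (+ k)
      unit k = cases (p ℕ.∣? k)
        where
        cases : Dec (p ℕ.∣ k) → 𝟙 (coprime? (p ^ suc m) k) ≡ f (+ k)
        cases (yes p∣k) = trans (𝟙-no (coprime? (p ^ suc m) k) (λ c → coprime-^⇒∤ m c p∣k))
                                (cong (λ z → 1ℤ - z) (sym (δ-yes p {+ k} (∣.∣ᵤ⇒∣ p∣k))))
        cases (no p∤k)  = trans (𝟙-yes (coprime? (p ^ suc m) k) (∤⇒coprime-^ (suc m) p∤k))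
                                (cong (λ z → 1ℤ - z) (sym (δ-no p {+ k} (λ p∣k → p∤k (∣.∣⇒∣ᵤ p∣k)))))

    -- The pigeonholes are the positions in the list of reduced residues, whose length is φ by
    -- definition.
    units-pigeonhole : ∀ m {k} → φ (p ^ suc m) < k → (u : Fin k → ℤ) → (∀ i → ¬ + p ∣ᶻ u i) →
      ∃ λ i → ∃ λ j → i Fin.< j × u i ≅ u j [ p ^ suc m ]
    units-pigeonhole m φ<k u u-unit =
      let i , j , i<j , eq = pigeonhole φ<k (λ i → index (residue∈ i)) in
      i , j , i<j , ≅-trans (≅-%ℕ (u i)) (≅-trans
        (≡⇒≅ (cong +_ (Membership.index-injective (setoid ℕ) (residue∈ i) (residue∈ j) eq)))
        (≅-sym (≅-%ℕ (u j))))
      where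
      P : ℕ
      P = p ^ suc m
      instance
        P≢0 : NonZero P
        P≢0 = ℕ.m^n≢0 p (suc m)
      residue∈ : ∀ i → u i %ℕ P ∈ filter (coprime? P) (upTo P)
      residue∈ i = ∈-filter⁺ (coprime? P) (∈-upTo⁺ (n%ℕd<d (u i) P)) (∤⇒coprime-^ (suc m) λ p∣ →
        u-unit i (∣-resp-≅ (≅-sym (≅-∣ (∣-^ m) (≅-%ℕ (u i)))) (∣.∣ᵤ⇒∣ p∣)))

  -- Parity is stated in the form in which it is used, as the sign of (-x)^k.
  Odd : ℕ → Set
  Odd k = -1ℤ ℤ.^ k ≡ -1ℤ

  Odd-* : ∀ j k → Odd j → Odd k → Odd (j ℕ.* k)
  Odd-* j k odd-j odd-k = trans (sym (ℤ.^-*-assoc -1ℤ j k)) (trans (cong (ℤ._^ k) odd-j) odd-k)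

  Odd-^ : ∀ j k → Odd j → Odd (j ^ k)
  Odd-^ j zero    odd-j = refl
  Odd-^ j (suc k) odd-j = Odd-* j (j ^ k) odd-j (Odd-^ j k odd-j)

  Odd-1+2k : ∀ k → Odd (1 ℕ.+ 2 ℕ.* k)
  Odd-1+2k k = cong (-1ℤ *_) (trans (sym (ℤ.^-*-assoc -1ℤ 2 k)) (ℤ.^-zeroˡ k))

  parity : ∀ k → -1ℤ ℤ.^ k ≡ 1ℤ ⊎ Odd k
  parity zero = inj₁ refl
  parity (suc k) with parity k
  ... | inj₁ even = inj₂ (cong (-1ℤ *_) even)
  ... | inj₂ odd  = inj₁ (cong (-1ℤ *_) odd)

  ^-distribʳ-* : ∀ x y k → (x * y) ℤ.^ k ≡ x ℤ.^ k * y ℤ.^ k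
  ^-distribʳ-* x y zero    = refl
  ^-distribʳ-* x y (suc k) = trans (cong (x * y *_) (^-distribʳ-* x y k)) (interchange x y _ _)
    where
    interchange : ∀ x y a b → x * y * (a * b) ≡ x * a * (y * b)
    interchange = solve-∀

  neg-^ : ∀ x k → (- x) ℤ.^ k ≡ -1ℤ ℤ.^ k * x ℤ.^ k
  neg-^ x k = trans (cong (ℤ._^ k) (sym (ℤ.-1*i≡-i x))) (^-distribʳ-* -1ℤ x k)

  1^-≅ : ∀ {m x} k → x ≅ 1ℤ [ m ] → x ℤ.^ k ≅ 1ℤ [ m ]
  1^-≅ k x≅1 = ≅-trans (^-cong-≅ k x≅1) (≡⇒≅ (ℤ.^-zeroˡ k))

  -- l has odd order h = φ(p ^ (m + 1)) / 2 modulo p ^ (m + 1), so its powers do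
  -- not contain -1, and together with their negatives they exhaust the units.
  module PowersOf (l : ℤ) (p : ℕ) (p-prime : Prime p) (p>2 : 2 < p) (m h : ℕ)
    (φ≡2h : φ (p ^ suc m) ≡ h ℕ.+ h) (h-odd : Odd h) (order : Order (p ^ suc m) l h)
    where

    P : ℕ
    P = p ^ suc m

    p∣P : p ℕ.∣ P
    p∣P = ∣-^ p-prime m

    Power : ℕ → ℤ → Set
    Power M x = ∃ λ r → x ≅ l ℤ.^ r [ M ]

    h>0 : 0 < h
    h>0 = Order.positive order

    lʰ≅1 : l ℤ.^ h ≅ 1ℤ [ P ]
    lʰ≅1 = ⌊ Order.power order ⌋

    Power-resp : ∀ {M x y} → x ≅ y [ M ] → Power M x → Power M y
    Power-resp x≅y (r , x≅lʳ) = r , ≅-trans (≅-sym x≅y) x≅lʳ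

    Power-∣ : ∀ {M M′ x} → M′ ℕ.∣ M → Power M x → Power M′ x
    Power-∣ M′∣M (r , x≅lʳ) = r , ≅-∣ M′∣M x≅lʳ

    Power-1 : ∀ {M} → Power M 1ℤ
    Power-1 = 0 , ≅-refl

    Power-* : ∀ {M x y} → Power M x → Power M y → Power M (x * y)
    Power-* (r , x≅) (r′ , y≅) = r ℕ.+ r′ , ≅-trans (*-cong-≅ x≅ y≅) (≡⇒≅ (sym (ℤ.^-distribˡ-+-* l r r′)))

    Power-^h : ∀ {M x} → M ℕ.∣ P → Power M x → x ℤ.^ h ≅ 1ℤ [ M ]
    Power-^h M∣P (r , x≅lʳ) = ≅-trans (^-cong-≅ h x≅lʳ) (≅-trans
      (≡⇒≅ (trans (ℤ.^-*-assoc l r h) (trans (cong (l ℤ.^_) (ℕ.*-comm r h)) (sym (ℤ.^-*-assoc l h r)))))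
      (1^-≅ r (≅-∣ M∣P lʰ≅1)))

    Power-inv : ∀ {M x} → M ℕ.∣ P → Power M x → ∃ λ y → Power M y × y * x ≅ 1ℤ [ M ]
    Power-inv {M} {x} M∣P x-power@(r , x≅lʳ) =
      -- The inverse is x^(h-1), because the h-th power of x is 1.
      x ℤ.^ ℕ.pred h , power (ℕ.pred h) ,
      ≅-trans (≡⇒≅ (trans (ℤ.*-comm (x ℤ.^ ℕ.pred h) x)
                          (cong (x ℤ.^_) (ℕ.suc-pred h {{ℕ.>-nonZero h>0}}))))
              (Power-^h M∣P x-power)
      where
      power : ∀ k → Power M (x ℤ.^ k)
      power zero    = Power-1
      power (suc k) = Power-* x-power (power k)

    ∤-of-^ : ∀ {x} k → 0 < k → x ℤ.^ k ≅ 1ℤ [ p ] → ¬ + p ∣ᶻ x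
    ∤-of-^ {x} (suc k) _ xᵏ≅1 p∣x = prime∤1 p-prime (∣.∣⇒∣ᵤ (∣-resp-≅ xᵏ≅1 (∣.∣m⇒∣m*n (x ℤ.^ k) p∣x)))

    Power-unit : ∀ {x} → Power p x → ¬ + p ∣ᶻ x
    Power-unit x-power = ∤-of-^ h h>0 (Power-^h p∣P x-power)

    1≇-1 : ¬ 1ℤ ≅ -1ℤ [ p ]
    1≇-1 ⌊ p∣2 ⌋ = ℕ.<⇒≱ p>2 (ℕ.∣⇒≤ (∣.∣⇒∣ᵤ p∣2))

    -- Powers of l have h-th power 1, but h is odd, so (-x)^h is -1 when x^h is 1.
    Power-skew : ∀ {x} → Power p x → ¬ Power p (- x)
    Power-skew {x} x-power -x-power = 1≇-1 (≅-trans (≅-sym (Power-^h p∣P -x-power))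
      (≅-trans (≡⇒≅ (trans (neg-^ x h) (cong (_* x ℤ.^ h) h-odd)))
               (*-congˡ-≅ -1ℤ (Power-^h p∣P x-power))))

    -- Minimality of h gives h ≤ k. Equality contradicts the oddness of h, and k = h + d with d > 0
    -- gives l^d = 1, hence d ≥ h and k ≥ 2h.
    l^even≇1 : ∀ k → 0 < k → k < h ℕ.+ h → -1ℤ ℤ.^ k ≡ 1ℤ → ¬ l ℤ.^ k ≅ 1ℤ [ P ]
    l^even≇1 k k>0 k<2h even lᵏ≅1 with ℕ.m≤n⇒∃[o]m+o≡n (Order.minimal order k k>0 (⌈_⌉ lᵏ≅1))
    ... | zero , refl =
      contradiction (trans (sym even) (trans (cong (-1ℤ ℤ.^_) (ℕ.+-identityʳ h)) h-odd)) λ ()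
    ... | suc d , refl = ℕ.<⇒≱ k<2h (ℕ.+-monoʳ-≤ h (Order.minimal order (suc d) (s≤s z≤n) ⌈ ≅-trans (≡⇒≅ (sym (ℤ.*-identityˡ (l ℤ.^ suc d))))
        (≅-trans (*-congʳ-≅ (l ℤ.^ suc d) (≅-sym lʰ≅1))
          (≅-trans (≡⇒≅ (sym (ℤ.^-distribˡ-+-* l h (suc d)))) lᵏ≅1)) ⌉))

    -- With `-l^2h≅1` this says that -l has order 2h = φ(P). For odd k the relation would make -1 a
    -- power of l.
    -l^k≇1 : ∀ k → 0 < k → k < h ℕ.+ h → ¬ (- l) ℤ.^ k ≅ 1ℤ [ P ]
    -l^k≇1 k k>0 k<2h e with parity k
    ... | inj₁ even = l^even≇1 k k>0 k<2h even (≅-trans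
            (≡⇒≅ (sym (trans (neg-^ l k) (trans (cong (_* l ℤ.^ k) even) (ℤ.*-identityˡ (l ℤ.^ k)))))) e)
    ... | inj₂ odd = Power-skew Power-1 (k , ≅-∣ p∣P (≅-trans (*-congˡ-≅ -1ℤ (≅-sym e))
            (≡⇒≅ (trans (cong (-1ℤ *_) (trans (neg-^ l k) (cong (_* l ℤ.^ k) odd))) (double-neg (l ℤ.^ k))))))
      where
      double-neg : ∀ x → -1ℤ * (-1ℤ * x) ≡ x
      double-neg = solve-∀

    -l^2h≅1 : (- l) ℤ.^ (h ℕ.+ h) ≅ 1ℤ [ P ]
    -l^2h≅1 = ≅-trans (≡⇒≅ (ℤ.^-distribˡ-+-* (- l) h h)) (*-cong-≅ -lʰ≅-1 -lʰ≅-1)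
      where
      -lʰ≅-1 : (- l) ℤ.^ h ≅ -1ℤ [ P ]
      -lʰ≅-1 = ≅-trans (≡⇒≅ (trans (neg-^ l h) (cong (_* l ℤ.^ h) h-odd))) (*-congˡ-≅ -1ℤ lʰ≅1)

    -- Multiplying by the complementary power (-l)^(2h-i) reduces the collision to (-l)^k = 1.
    -l^-injective : ∀ i k → 0 < k → i ℕ.+ k < h ℕ.+ h → ¬ (- l) ℤ.^ i ≅ (- l) ℤ.^ (i ℕ.+ k) [ P ]
    -l^-injective i k k>0 i+k<2h e
      with i′ , i+i′≡2h ← ℕ.m≤n⇒∃[o]m+o≡n (ℕ.≤-trans (ℕ.m≤m+n i k) (ℕ.<⇒≤ i+k<2h)) =
      -l^k≇1 k k>0 (ℕ.≤-<-trans (ℕ.m≤n+m k i) i+k<2h) (≅-trans (≅-sym (shift-back i′ i+i′≡2h)) (cycle i′ i+i′≡2h))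
      where
      L : ℕ → ℤ
      L = (- l) ℤ.^_
      cycle : ∀ i′ → i ℕ.+ i′ ≡ h ℕ.+ h → L i * L i′ ≅ 1ℤ [ P ]
      cycle i′ eq = ≅-trans (≡⇒≅ (trans (sym (ℤ.^-distribˡ-+-* (- l) i i′)) (cong L eq))) -l^2h≅1
      regroup : ∀ a b c → a * b * c ≡ a * c * b
      regroup = solve-∀
      shift-back : ∀ i′ → i ℕ.+ i′ ≡ h ℕ.+ h → L i * L i′ ≅ L k [ P ]
      shift-back i′ eq = ≅-trans (*-congʳ-≅ (L i′) e) (≅-trans
        (≡⇒≅ (trans (cong (_* L i′) (ℤ.^-distribˡ-+-* (- l) i k)) (regroup (L i) (L k) (L i′))))
        (≅-trans (*-congʳ-≅ (L k) (cycle i′ eq)) (≡⇒≅ (ℤ.*-identityˡ (L k)))))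

    -- The powers of -l with exponents below 2h = φ(P) are distinct units. With x added there is one
    -- unit too many, so x is congruent to one of them, and the parity of the exponent decides the
    -- sign.
    exhaust : ∀ x → ¬ + p ∣ᶻ x → Power P x ⊎ Power P (- x)
    exhaust x p∤x = conclude (units-pigeonhole p-prime m (s≤s (ℕ.≤-reflexive φ≡2h)) u u-unit)
      where
      u : Fin (suc (h ℕ.+ h)) → ℤ
      u Fin.zero    = x
      u (Fin.suc j) = (- l) ℤ.^ toℕ j
      u-unit : ∀ i → ¬ + p ∣ᶻ u i
      u-unit Fin.zero    = p∤x
      u-unit (Fin.suc j) = ∤-of-^ (h ℕ.+ h) (ℕ.≤-trans h>0 (ℕ.m≤m+n h h)) (≅-trans
        (≡⇒≅ (trans (ℤ.^-*-assoc (- l) (toℕ j) (h ℕ.+ h)) (trans (cong ((- l) ℤ.^_) (ℕ.*-comm (toℕ j) (h ℕ.+ h)))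
          (sym (ℤ.^-*-assoc (- l) (h ℕ.+ h) (toℕ j))))))
        (1^-≅ (toℕ j) (≅-∣ p∣P -l^2h≅1)))
      conclude : (∃ λ i → ∃ λ j → i Fin.< j × u i ≅ u j [ P ]) → Power P x ⊎ Power P (- x)
      conclude (Fin.zero , Fin.suc j , _ , x≅) with parity (toℕ j)
      ... | inj₁ even = inj₁ (toℕ j , ≅-trans x≅ (≡⇒≅
              (trans (neg-^ l (toℕ j)) (trans (cong (_* l ℤ.^ toℕ j) even) (ℤ.*-identityˡ (l ℤ.^ toℕ j))))))
      ... | inj₂ odd  = inj₂ (toℕ j , ≅-trans (neg-cong-≅ x≅) (≡⇒≅
              (trans (cong -_ (trans (neg-^ l (toℕ j)) (cong (_* l ℤ.^ toℕ j) odd))) (double-neg (l ℤ.^ toℕ j)))))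
        where
        double-neg : ∀ x → - (-1ℤ * x) ≡ x
        double-neg = solve-∀
      conclude (Fin.suc i , Fin.suc j , s≤s i<j , e) with d , eq ← ℕ.m≤n⇒∃[o]m+o≡n i<j =
        contradiction (subst (λ z → (- l) ℤ.^ toℕ i ≅ (- l) ℤ.^ z [ P ]) j≡ e)
          (-l^-injective (toℕ i) (suc d) (s≤s z≤n) (subst (_< h ℕ.+ h) j≡ (toℕ<n j)))
        where
        j≡ : toℕ j ≡ toℕ i ℕ.+ suc d
        j≡ = sym (trans (ℕ.+-suc (toℕ i) d) eq)

    split-mod-P : ∀ x → + p ∣ᶻ x ⊎ Power P x ⊎ Power P (- x)
    split-mod-P x with + p ∣ᶻ? x
    ... | yes p∣x = inj₁ p∣x
    ... | no p∤x  = inj₂ (exhaust x p∤x)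

    -- Modulo P either x or -x is a power of l; the second case, reduced modulo p, contradicts
    -- `Power-skew`.
    Power-lift : ∀ {x} → Power p x → Power P x
    Power-lift {x} x-power with split-mod-P x
    ... | inj₁ p∣x              = contradiction p∣x (Power-unit x-power)
    ... | inj₂ (inj₁ x-powerP)  = x-powerP
    ... | inj₂ (inj₂ -x-powerP) = contradiction (Power-∣ p∣P -x-powerP) (Power-skew x-power)

    split-mod-p : ∀ x → + p ∣ᶻ x ⊎ Power p x ⊎ Power p (- x)
    split-mod-p x with split-mod-P x
    ... | inj₁ p∣x       = inj₁ p∣x
    ... | inj₂ (inj₁ y)  = inj₂ (inj₁ (Power-∣ p∣P y))
    ... | inj₂ (inj₂ y)  = inj₂ (inj₂ (Power-∣ p∣P y))

    -- A primitive root is not a power of l, so its negative is one.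
    primitiveRoot-skew : ∀ {g} → PrimitiveRoot P g → Power P (- g)
    primitiveRoot-skew {g} root = [ (λ g-power → contradiction (minimal g-power) (ℕ.<⇒≱ h<φ)) , id ]′ (exhaust g unit)
      where
      h<φ : h < φ P
      h<φ = subst (h <_) (sym φ≡2h) (ℕ.m<n+m h h>0)
      minimal : Power P g → φ P ℕ.≤ h
      minimal g-power = Order.minimal root h h>0 (⌈_⌉ (Power-^h ℕ.∣-refl g-power))
      unit : ¬ + p ∣ᶻ g
      unit = ∤-of-^ (φ P) (Order.positive root) (≅-∣ p∣P ⌊ Order.power root ⌋)

  -- Cyclotomic cosets

  pos-^ : ∀ l r → + (l ^ r) ≡ (+ l) ℤ.^ r
  pos-^ l zero    = refl
  pos-^ l (suc r) = trans (ℤ.pos-* l (l ^ r)) (cong (+ l *_) (pos-^ l r))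

  module Represent (l n p j M : ℕ) .{{_ : NonZero n}} .{{_ : NonZero p}} .{{_ : NonZero M}}
    (n≡ : n ≡ p ^ j ℕ.* p ℕ.* M) where

    open Polynomial (𝔽 l)
    open CyclicCoefficients l n

    record Represents (f : Poly) (u : ℤ → ℤ) : Set where
      field
        on  : ∀ x → fold f (x * + M) ≡ u x
        off : ∀ d → ¬ + M ∣ᶻ d → fold f d ≡ 0ℤ
    open Represents

    represents-+ : ∀ {f g u v} → Represents f u → Represents g v → Represents (f +ᴾ g) (λ x → u x + v x)
    represents-+ {f} {g} F G = record
      { on  = λ x → trans (fold-+ f g (x * + M)) (cong₂ _+_ (on F x) (on G x))
      ; off = λ d M∤d → trans (fold-+ f g d) (cong₂ _+_ (off F d M∤d) (off G d M∤d))
      }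

    represents-constant* : ∀ c {f u} → Represents f u → Represents (constant c *ᴾ f) (λ x → c * u x)
    represents-constant* c {f} F = record
      { on  = λ x → trans (fold-constant* c f (x * + M)) (cong (c *_) (on F x))
      ; off = λ d M∤d → trans (fold-constant* c f d) (trans (cong (c *_) (off F d M∤d)) (ℤ.*-zeroʳ c))
      }

    -- Only multiples y M contribute to the convolution, with y running modulo p^(j+1). The summand
    -- has period p in y, which yields the factor p^j.
    represents-* : ∀ {f g u v} → Periodic p u → Periodic p v → Represents f u → Represents g v →
      Represents (f *ᴾ g) (λ x → + (p ^ j) * S p (λ y → u y * v (x - y)))
    represents-* {f} {g} {u} {v} u-per v-per F G = record
      { on  = λ x → trans (convolution (x * + M)) (trans
          (S-cong (p ^ j ℕ.* p) (λ y → cong₂ _*_ (on F y) (trans (cong (fold g) (factor x y (+ M))) (on G (x - y)))))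
          (S-periodic (p ^ j) p (λ {y} {z} y≅z → cong₂ _*_ (u-per y≅z) (v-per (+-congˡ-≅ x (neg-cong-≅ y≅z))))))
      ; off = λ d M∤d → trans (convolution d) (S-0 (p ^ j ℕ.* p) (λ y → trans
          (cong (fold f (y * + M) *_) (off G (d - y * + M) (λ M∣ → M∤d (subst (+ M ∣ᶻ_) (restore d (y * + M))
            (∣.∣m∣n⇒∣m+n M∣ (divides y refl))))))
          (ℤ.*-zeroʳ (fold f (y * + M)))))
      }
      where
      factor : ∀ x y M → x * M - y * M ≡ (x - y) * M
      factor = solve-∀
      restore : ∀ d z → d - z + z ≡ d
      restore = solve-∀
      convolution : ∀ d → fold (f *ᴾ g) d ≡ S (p ^ j ℕ.* p) (λ y → fold f (y * + M) * fold g (d - y * + M))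
      convolution d = trans (fold-* f g d) (trans (cong (λ z → S z (λ y → fold f y * fold g (d - y))) n≡)
        (S-multiples {M} (p ^ j ℕ.* p) (λ y M∤y → cong (_* fold g (d - y)) (off F y M∤y))))

    represents-injective : ∀ {f g u v} → Represents f u → Represents g v → (∀ x → u x ≡ v x) →
      ∃ λ h → (f +ᴾ map -_ g) ≈ᴾ h *ᴾ modulus
    represents-injective {f} {g} F G u≗v = fold-injective f g (λ d → cases d (+ M ∣ᶻ? d))
      where
      cases : ∀ d → Dec (+ M ∣ᶻ d) → fold f d ≡ fold g d
      cases d (yes (divides x refl)) = trans (on F x) (trans (u≗v x) (sym (on G x)))
      cases d (no M∤d)               = trans (off F d M∤d) (sym (off G d M∤d))

  module Cosets (p a m : ℕ) (p-prime : Prime p) (p≡ : p ≡ 3 ℕ.+ 4 ℕ.* a) (Qt : ℕ) .{{_ : NonZero Qt}}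
    (l : ℕ) (g : ℤ)
    (order : Order (p ^ suc m) (+ l) (φ (p ^ suc m) / 2)) (root : PrimitiveRoot (p ^ suc m) g) where

    -- This is φ(p^(j+1))/2, with (p - 1)/2 written as 1 + 2a to make its oddness visible.
    half : ℕ → ℕ
    half j = p ^ j ℕ.* (1 ℕ.+ 2 ℕ.* a)

    φ≡half+half : ∀ j → φ (p ^ suc j) ≡ half j ℕ.+ half j
    φ≡half+half j = ℤ.+-injective (trans (φ-prime-power p-prime j) (trans
      (cong (λ z → + (p ^ j) * z) (cong (λ z → + z - 1ℤ) p≡))
      (trans (sym (ℤ.pos-* (p ^ j) (2 ℕ.+ 4 ℕ.* a))) (cong +_ (eq (p ^ j) a)))))
      where
      eq : ∀ x a → x ℕ.* (2 ℕ.+ 4 ℕ.* a) ≡ x ℕ.* (1 ℕ.+ 2 ℕ.* a) ℕ.+ x ℕ.* (1 ℕ.+ 2 ℕ.* a)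
      eq = ℕ-Solver.solve-∀

    φ/2≡half : ∀ j → φ (p ^ suc j) / 2 ≡ half j
    φ/2≡half j = trans (cong (_/ 2) (trans (φ≡half+half j) (eq (half j)))) (ℕ.m*n/n≡m (half j) 2)
      where
      eq : ∀ x → x ℕ.+ x ≡ x ℕ.* 2
      eq = ℕ-Solver.solve-∀

    instance
      p≢0 : NonZero p
      p≢0 = prime⇒nonZero p-prime

    M : ℕ → ℕ
    M k = p ^ k ℕ.* Qt

    M≢0 : ∀ k → NonZero (M k)
    M≢0 k = ℕ.m*n≢0 (p ^ k) Qt {{ℕ.m^n≢0 p k}}

    n : ℕ
    n = p ^ suc m ℕ.* Qt

    instance
      n≢0 : NonZero n
      n≢0 = M≢0 (suc m)

    p-odd : Odd p
    p-odd = subst Odd (trans (eq a) (sym p≡)) (Odd-1+2k (1 ℕ.+ 2 ℕ.* a))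
      where
      eq : ∀ a → 1 ℕ.+ 2 ℕ.* (1 ℕ.+ 2 ℕ.* a) ≡ 3 ℕ.+ 4 ℕ.* a
      eq = ℕ-Solver.solve-∀

    open PowersOf (+ l) p p-prime (subst (2 <_) (sym p≡) (ℕ.m≤m+n 3 (4 ℕ.* a))) m (half m) (φ≡half+half m)
      (Odd-* (p ^ m) (1 ℕ.+ 2 ℕ.* a) (Odd-^ p m p-odd) (Odd-1+2k a))
      (subst (Order (p ^ suc m) (+ l)) (φ/2≡half m) order) public

    module Q = SkewSubgroup p (Power p) Power-resp Power-1 Power-* (Power-inv p∣P) Power-unit Power-skew split-mod-p
    open Q using (e; e-periodic; e-partition)

    -- From h = 2 `Q.a` + 1 and p = 2h + 1 follows p = 3 + 4 `Q.a`, to be compared with p = 3 + 4a.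
    Q-a≡a : Q.a ≡ + a
    Q-a≡a = ℤ.*-cancelˡ-≡ (+ 4) Q.a (+ a) (∙-cancelˡ (+ 3) _ _ (begin
      + 3 + + 4 * Q.a                                ≡⟨ regroup Q.a ⟩
      Q.a + Q.a + 1ℤ + (Q.a + Q.a + 1ℤ) + 1ℤ         ≡⟨ cong (λ z → z + z + 1ℤ) Q.h≡2a+1 ⟨
      Q.h + Q.h + 1ℤ                                 ≡⟨ Q.h-double ⟩
      + p                                            ≡⟨ cong +_ p≡ ⟩
      + 3 + + (4 ℕ.* a)                              ≡⟨ cong (λ z → + 3 + z) (ℤ.pos-* 4 a) ⟩
      + 3 + + 4 * + a                                ∎))
      where
      open ≡-Reasoning
      regroup : ∀ a → + 3 + + 4 * a ≡ a + a + 1ℤ + (a + a + 1ℤ) + 1ℤ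
      regroup = solve-∀

    open Polynomial (𝔽 l)
    open CyclicCoefficients l n

    cosetSum : ℤ → Poly
    cosetSum γ = foldr _+ᴾ_ [] (map (λ α → X^ (toℕ α)) (coset n l γ))

    fold-coset : ∀ γ d {A : Set} (A? : Dec A) → (∀ r → d ≅ γ * (+ l) ℤ.^ r [ n ] → A) →
      (A → ∃ λ r → d ≅ γ * (+ l) ℤ.^ r [ n ]) → fold (cosetSum γ) d ≡ 𝟙 A?
    fold-coset γ d A? to from = trans (fold-subset (inCoset? n l γ) d) (𝟙-⇔ (inCoset? n l γ (residue d)) A?
      (λ (r , α≋) → to r (≅-trans (≅-sym (residue-≅ d)) (≅-trans ⌊ α≋ ⌋ (≡⇒≅ (cong (γ *_) (pos-^ l r))))))
      (λ x → let r , d≅ = from x in r , ⌈_⌉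
        (≅-trans (residue-≅ d) (≅-trans d≅ (≡⇒≅ (cong (γ *_) (sym (pos-^ l r))))))))

    -- Multiples of p^k q^t modulo n as residues modulo p^(j+1)

    module Level (k j : ℕ) (k+j≡m : k ℕ.+ j ≡ m) where

      n≡NM : n ≡ p ^ suc j ℕ.* M k
      n≡NM = trans (cong (ℕ._* Qt) (trans (cong (λ z → p ℕ.* p ^ z) (sym k+j≡m))
        (cong (p ℕ.*_) (ℕ.^-distribˡ-+-* p k j)))) (eq p (p ^ k) (p ^ j) Qt)
        where
        eq : ∀ p x y z → p ℕ.* (x ℕ.* y) ℕ.* z ≡ p ℕ.* y ℕ.* (x ℕ.* z)
        eq = ℕ-Solver.solve-∀

      instance
        Mk≢0 : NonZero (M k)
        Mk≢0 = M≢0 k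

      open Represent l n p j (M k) (trans n≡NM (cong (ℕ._* M k) (ℕ.*-comm p (p ^ j)))) public

      M∣n : M k ℕ.∣ n
      M∣n = ℕ.divides (p ^ suc j) n≡NM

      N∣P : p ^ suc j ℕ.∣ P
      N∣P = ℕ.divides (p ^ k) (trans (cong (λ z → p ℕ.* p ^ z) (sym k+j≡m))
        (trans (cong (p ℕ.*_) (ℕ.^-distribˡ-+-* p k j)) (eq p (p ^ k) (p ^ j))))
        where
        eq : ∀ p x y → p ℕ.* (x ℕ.* y) ≡ x ℕ.* (p ℕ.* y)
        eq = ℕ-Solver.solve-∀

      expand : ∀ x y → x ≅ y [ p ^ suc j ] → x * + M k ≅ y * + M k [ n ]
      expand x y ⌊ N∣ ⌋ = ⌊ subst₂ _∣ᶻ_ (trans (sym (ℤ.pos-* (p ^ suc j) (M k))) (cong +_ (sym n≡NM)))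
                             (eq x y (+ M k)) (∣.*-monoˡ-∣ (+ M k) N∣) ⌋
        where
        eq : ∀ x y M → (x - y) * M ≡ x * M - y * M
        eq = solve-∀

      reduce : ∀ x y → x * + M k ≅ y * + M k [ n ] → x ≅ y [ p ^ suc j ]
      reduce x y ⌊ n∣ ⌋ = ⌊ ∣.*-cancelʳ-∣ (+ M k) (subst₂ _∣ᶻ_
          (trans (cong +_ n≡NM) (ℤ.pos-* (p ^ suc j) (M k))) (eq x y (+ M k)) n∣) ⌋
        where
        eq : ∀ x y M → x * M - y * M ≡ (x - y) * M
        eq = solve-∀

      -- As M k divides n, the whole coset consists of multiples of M k, and dividing by M k leaves
      -- c times the powers of l modulo p^(j+1). The map σ turns membership in this set into being a
      -- power of l modulo p: it is the identity for χ and negation for χ*.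
      coset-represents : ∀ γ c → γ ≡ + M k * c → (σ : ℤ → ℤ) →
        (∀ x r → x ≅ c * (+ l) ℤ.^ r [ p ^ suc j ] → Power p (σ x)) →
        (∀ x → Power p (σ x) → ∃ λ r → x ≅ c * (+ l) ℤ.^ r [ p ^ suc j ]) →
        Represents (cosetSum γ) (λ x → e (σ x))
      coset-represents γ c γ≡ σ to from = record
        { on  = λ x → trans (fold-coset γ (x * + M k) (Q.Q? (σ x))
            (λ r eq → to x r (reduce x _ (≅-trans eq (≡⇒≅ (commute r)))))
            (λ y → let r , x≅ = from x y in r , ≅-trans (expand x _ x≅) (≡⇒≅ (sym (commute r)))))
            (sym (Q.e≡𝟙 (σ x)))
        ; off = λ d M∤d → trans
            (fold-coset γ d (+ M k ∣ᶻ? d)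
              (λ r d≅ → ∣-resp-≅ (≅-sym (≅-∣ M∣n d≅)) (subst (+ M k ∣ᶻ_) (sym (commute r)) (divides (c * (+ l) ℤ.^ r) refl)))
              (λ M∣d → contradiction M∣d M∤d))
            (δ-no (M k) M∤d)
        }
        where
        assoc : ∀ M c L → M * c * L ≡ c * L * M
        assoc = solve-∀
        commute : ∀ r → γ * (+ l) ℤ.^ r ≡ c * (+ l) ℤ.^ r * + M k
        commute r = trans (cong (_* (+ l) ℤ.^ r) γ≡) (assoc (+ M k) c ((+ l) ℤ.^ r))

      χ χ* : Poly
      χ  = cosetSum (+ M k)
      χ* = cosetSum (+ M k * g)

      p∣N : p ℕ.∣ p ^ suc j
      p∣N = ∣-^ p-prime j

      χ-represents : Represents χ e
      χ-represents = coset-represents (+ M k) 1ℤ (sym (ℤ.*-identityʳ (+ M k))) id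
        (λ x r x≅ → r , ≅-∣ p∣N (≅-trans x≅ (≡⇒≅ (ℤ.*-identityˡ ((+ l) ℤ.^ r)))))
        (λ x x-power → let r , x≅ = Power-∣ N∣P (Power-lift x-power) in
           r , ≅-trans x≅ (≡⇒≅ (sym (ℤ.*-identityˡ ((+ l) ℤ.^ r)))))

      -- Since -g is a power of l, multiplying the powers of l by g gives exactly their negatives.
      χ*-represents : Represents χ* (λ x → e (- x))
      χ*-represents = coset-represents (+ M k * g) g refl -_ to from
        where
        -g-power : Power P (- g)
        -g-power = primitiveRoot-skew root
        neg-distrib : ∀ x y → - x * y ≡ - (x * y)
        neg-distrib = solve-∀
        to : ∀ x r → x ≅ g * (+ l) ℤ.^ r [ p ^ suc j ] → Power p (- x)
        to x r x≅ = Power-resp (≅-trans (≡⇒≅ (neg-distrib g ((+ l) ℤ.^ r))) (neg-cong-≅ (≅-sym (≅-∣ p∣N x≅))))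
          (Power-* (Power-∣ p∣P -g-power) (r , ≅-refl))
        regroup : ∀ g x y → g * (y * - x) ≡ y * - g * x
        regroup = solve-∀
        from : ∀ x → Power p (- x) → ∃ λ r → x ≅ g * (+ l) ℤ.^ r [ p ^ suc j ]
        from x -x-power =
          -- With y inverse to -g, the power y (-x) is x / g, so its exponent is the required r.
          let y , y-power , y*-g≅1 = Power-inv ℕ.∣-refl -g-power
              r , y*-x≅ = Power-* y-power (Power-lift -x-power)
          in r , ≅-sym (≅-trans (*-congˡ-≅ g (≅-sym (≅-∣ N∣P y*-x≅))) (≅-trans (≡⇒≅ (regroup g x y))
                   (≅-trans (*-congʳ-≅ x (≅-∣ N∣P y*-g≅1)) (≡⇒≅ (ℤ.*-identityˡ x)))))

      δ-M-suc : ∀ x → δ (M (suc k)) (x * + M k) ≡ δ p x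
      δ-M-suc x = 𝟙-⇔ (+ M (suc k) ∣ᶻ? (x * + M k)) (+ p ∣ᶻ? x)
        (λ M∣ → ∣.*-cancelʳ-∣ (+ M k) (subst (_∣ᶻ x * + M k) M-suc M∣))
        (λ p∣x → subst (_∣ᶻ x * + M k) (sym M-suc) (∣.*-monoˡ-∣ (+ M k) p∣x))
        where
        M-suc : + M (suc k) ≡ + p * + M k
        M-suc = trans (cong +_ (ℕ.*-assoc p (p ^ k) Qt)) (ℤ.pos-* p (M k))

      δ-M-suc-off : ∀ {d} → ¬ + M k ∣ᶻ d → δ (M (suc k)) d ≡ 0ℤ
      δ-M-suc-off M∤d = δ-no (M (suc k)) (λ M∣d → M∤d (∣.∣-trans (∣.∣ᵤ⇒∣
        (ℕ.divides p (ℕ.*-assoc p (p ^ k) Qt))) M∣d))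

      -- The two cosets together are the multiples of M k that are not multiples of M (k + 1); this
      -- form makes sums over k telescope.
      fold-χ+χ* : ∀ d → fold (χ +ᴾ χ*) d ≡ δ (M k) d - δ (M (suc k)) d
      fold-χ+χ* d = cases (+ M k ∣ᶻ? d)
        where
        open Represents (represents-+ χ-represents χ*-represents)
        isolate : ∀ x y → x ≡ x + y - y
        isolate = solve-∀
        cases : Dec (+ M k ∣ᶻ d) → fold (χ +ᴾ χ*) d ≡ δ (M k) d - δ (M (suc k)) d
        cases (yes (divides x refl)) = trans (on x) (trans (isolate (e x + e (- x)) (δ p x))
          (cong₂ _-_ (trans (e-partition x) (sym (δ-yes (M k) (divides x refl)))) (sym (δ-M-suc x))))
        cases (no M∤d) = trans (off d M∤d) (sym (cong₂ _-_ (δ-no (M k) M∤d) (δ-M-suc-off M∤d)))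

    -- Telescoping over the levels above i

    pair : ℕ → Poly
    pair k = cosetSum (+ M k) +ᴾ cosetSum (+ M k * g)

    upperSum : ℕ → ℕ → Poly
    upperSum i k = foldr _+ᴾ_ [] (map pair (filter (i <?_) (upTo k)))

    fold-∷ʳ : ∀ fs f d → fold (foldr _+ᴾ_ [] (fs ++ f)) d ≡ fold (foldr _+ᴾ_ [] fs) d + fold (foldr _+ᴾ_ [] f) d
    fold-∷ʳ []       f d = sym (ℤ.+-identityˡ _)
    fold-∷ʳ (f₀ ∷ fs) f d = trans (fold-+ f₀ _ d) (trans (cong₂ _+_ {fold f₀ d} refl (fold-∷ʳ fs f d))
      (trans (sym (ℤ.+-assoc (fold f₀ d) _ _)) (cong (_+ fold (foldr _+ᴾ_ [] f) d) (sym (fold-+ f₀ _ d)))))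

    fold-upperSum-suc : ∀ i k d → fold (upperSum i (suc k)) d ≡ fold (upperSum i k) d + 𝟙 (i <? k) * fold (pair k) d
    fold-upperSum-suc i k d = trans
      (cong (λ ks → fold (foldr _+ᴾ_ [] ks) d) (trans
        (cong (map pair) (trans (cong (filter (i <?_)) (sym (List.upTo-∷ʳ k))) (List.filter-++ (i <?_) (upTo k) (k ∷ []))))
        (List.map-++ pair (filter (i <?_) (upTo k)) _)))
      (trans (fold-∷ʳ (map pair (filter (i <?_) (upTo k))) _ d)
        (cong₂ _+_ {fold (upperSum i k) d} refl (last (i <? k))))
      where
      last : (i<k? : Dec (i < k)) → fold (foldr _+ᴾ_ [] (map pair (filter (i <?_) (k ∷ [])))) d ≡ 𝟙 (i <? k) * fold (pair k) d
      last (yes i<k) = trans (cong (λ ks → fold (foldr _+ᴾ_ [] (map pair ks)) d) (List.filter-accept (i <?_) {xs = []} i<k))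
        (trans (fold-+ (pair k) [] d) (trans (ℤ.+-identityʳ _) (sym (trans (cong (_* fold (pair k) d) (𝟙-yes (i <? k) i<k)) (ℤ.*-identityˡ _)))))
      last (no i≮k) = trans (cong (λ ks → fold (foldr _+ᴾ_ [] (map pair ks)) d) (List.filter-reject (i <?_) {xs = []} i≮k))
        (sym (cong (_* fold (pair k) d) (𝟙-no (i <? k) i≮k)))

    -- Consecutive pairs telescope; the indicator in front makes the right side vanish when k ≤ i,
    -- where the sum is empty.
    fold-upperSum : ∀ i k d → k ≤ suc m → fold (upperSum i k) d ≡ 𝟙 (i <? k) * (δ (M (suc i)) d - δ (M k) d)
    fold-upperSum i zero    d _         = refl
    fold-upperSum i (suc k) d (s≤s k≤m) = trans (fold-upperSum-suc i k d)
      (trans (cong₂ (λ y z → y + 𝟙 (i <? k) * z) (fold-upperSum i k d (ℕ.m≤n⇒m≤1+n k≤m))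
        (let j , k+j≡m = ℕ.m≤n⇒∃[o]m+o≡n k≤m in Level.fold-χ+χ* k j k+j≡m d))
      (cases (ℕ.<-cmp i k)))
      where
      telescope : ∀ x y z → 1ℤ * (x - y) + 1ℤ * (y - z) ≡ 1ℤ * (x - z)
      telescope = solve-∀
      empty : ∀ x → 0ℤ ≡ 1ℤ * (x - x)
      empty = solve-∀
      G : ℕ → ℤ
      G k = δ (M k) d
      cases : Tri (i < k) (i ≡ k) (k < i) →
        𝟙 (i <? k) * (G (suc i) - G k) + 𝟙 (i <? k) * (G k - G (suc k)) ≡ 𝟙 (i <? suc k) * (G (suc i) - G (suc k))
      cases (tri< i<k _ _) rewrite 𝟙-yes (i <? k) i<k | 𝟙-yes (i <? suc k) (ℕ.m<n⇒m<1+n i<k) =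
        telescope (G (suc i)) (G k) (G (suc k))
      cases (tri≈ i≮k refl _) rewrite 𝟙-no (i <? i) i≮k | 𝟙-yes (i <? suc i) (ℕ.n<1+n i) = empty (G (suc i))
      cases (tri> i≮k i≢k _) rewrite 𝟙-no (i <? k) i≮k
                                   | 𝟙-no (i <? suc k) (λ i<1+k → i≢k (ℕ.≤-antisym (ℕ.<⇒≤pred i<1+k) (ℕ.≮⇒≥ i≮k))) = refl

    -- `A`, `B` and `C` are variables tied to their values by equations, so that the results apply
    -- to the coefficients as the theorem writes them.
    module Products (i j : ℕ) (i+j≡m : i ℕ.+ j ≡ m) (A B C : ℕ)
      (A≡ : A ≡ a ℕ.* p ^ j) (B≡ : B ≡ suc a ℕ.* p ^ j) (C≡ : C ≡ half j) where

      open Level i j i+j≡m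

      A≡ᶻ : + A ≡ + (p ^ j) * Q.a
      A≡ᶻ = trans (cong +_ A≡) (trans (ℤ.pos-* a (p ^ j)) (trans (ℤ.*-comm (+ a) (+ (p ^ j))) (cong (+ (p ^ j) *_) (sym Q-a≡a))))

      B≡ᶻ : + B ≡ + (p ^ j) * (Q.a + 1ℤ)
      B≡ᶻ = trans (cong +_ B≡) (trans (ℤ.pos-* (suc a) (p ^ j)) (trans (ℤ.*-comm (+ suc a) (+ (p ^ j)))
        (cong (+ (p ^ j) *_) (trans (ℤ.+-comm 1ℤ (+ a)) (cong (_+ 1ℤ) (sym Q-a≡a))))))

      C≡ᶻ : + C ≡ + (p ^ j) * Q.h
      C≡ᶻ = trans (cong +_ C≡) (trans (ℤ.pos-* (p ^ j) (1 ℕ.+ 2 ℕ.* a)) (cong (+ (p ^ j) *_)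
        (sym (trans Q.h≡2a+1 (trans (cong (λ z → z + z + 1ℤ) Q-a≡a) (cong +_ (eq a)))))))
        where
        eq : ∀ a → a ℕ.+ a ℕ.+ 1 ≡ 1 ℕ.+ 2 ℕ.* a
        eq = ℕ-Solver.solve-∀

      e-periodic⁻ : Periodic p (λ x → e (- x))
      e-periodic⁻ x≅y = e-periodic (neg-cong-≅ x≅y)

      combine : ∀ P a x y → P * (a * x + (a + 1ℤ) * y) ≡ P * a * x + P * (a + 1ℤ) * y
      combine = solve-∀

      -- The telescoped sum ends with -`δ n`, as M (m + 1) = n, and the constant 1 folds to `δ n`.
      -- What remains is the indicator of the multiples of p M i.
      rest-represents : Represents (upperSum i (suc m) +ᴾ constant 1ℤ) (δ p)
      rest-represents = record
        { on  = λ x → trans (fold-rest (x * + M i)) (δ-M-suc x)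
        ; off = λ d M∤d → trans (fold-rest d) (δ-M-suc-off M∤d)
        }
        where
        i<s : i < suc m
        i<s = s≤s (subst (i ≤_) i+j≡m (ℕ.m≤m+n i j))
        cancel : ∀ x y → 1ℤ * (x - y) + (1ℤ * y + 0ℤ) ≡ x
        cancel = solve-∀
        fold-rest : ∀ d → fold (upperSum i (suc m) +ᴾ constant 1ℤ) d ≡ δ (M (suc i)) d
        fold-rest d = trans (fold-+ (upperSum i (suc m)) (constant 1ℤ) d) (trans
          (cong (_+ (1ℤ * δ n d + 0ℤ)) (trans (fold-upperSum i (suc m) d ℕ.≤-refl)
            (cong (_* (δ (M (suc i)) d - δ n d)) (𝟙-yes (i <? suc m) i<s))))
          (cancel (δ (M (suc i)) d) (δ n d)))

      self-product : ∀ x → + (p ^ j) * S p (λ y → e y * e (x - y)) ≡ + A * e x + + B * e (- x)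
      self-product x = trans (cong (+ (p ^ j) *_) (Q.selfconvolution x))
        (trans (combine (+ (p ^ j)) Q.a (e x) (e (- x))) (cong₂ (λ y z → y * e x + z * e (- x)) (sym A≡ᶻ) (sym B≡ᶻ)))

      -- Reflecting y turns this into `self-product` at -x.
      self-product* : ∀ x → + (p ^ j) * S p (λ y → e (- y) * e (- (x - y))) ≡ + A * e (- x) + + B * e x
      self-product* x = trans (cong (+ (p ^ j) *_) reflected) (trans (self-product (- x))
        (cong (λ z → + A * e (- x) + + B * e z) (ℤ.neg-involutive x)))
        where
        distrib : ∀ x y → - (x - y) ≡ - x - - y
        distrib = solve-∀
        reflected : S p (λ y → e (- y) * e (- (x - y))) ≡ S p (λ y → e y * e (- x - y))
        reflected = trans (S-cong p (λ y → cong (λ z → e (- y) * e z) (distrib x y)))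
          (S-reflect {f = λ y → e y * e (- x - y)}
            (λ y≅z → cong₂ _*_ (e-periodic y≅z) (e-periodic (+-congˡ-≅ (- x) (neg-cong-≅ y≅z)))))

      -- The sign in χ* turns the convolution into the autocorrelation of `e`, since -(x - y) = y -
      -- x.
      mixed-product : ∀ x → + (p ^ j) * S p (λ y → e y * e (- (x - y))) ≡ + A * (e x + e (- x)) + + C * δ p x
      mixed-product x = trans
        (cong (+ (p ^ j) *_) (trans (S-cong p (λ y → cong (λ z → e y * e z) (flip x y))) (Q.autocorrelation x)))
        (trans (distrib (+ (p ^ j)) Q.a (e x + e (- x)) Q.h (δ p x))
          (cong₂ (λ y z → y * (e x + e (- x)) + z * δ p x) (sym A≡ᶻ) (sym C≡ᶻ)))
        where
        flip : ∀ x y → - (x - y) ≡ y - x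
        flip = solve-∀
        distrib : ∀ P a x h y → P * (a * x + h * y) ≡ P * a * x + P * h * y
        distrib = solve-∀

      χ² : ∃ λ h → (χ *ᴾ χ) +ᴾ map -_ (constant (+ A) *ᴾ χ +ᴾ constant (+ B) *ᴾ χ*) ≈ᴾ h *ᴾ modulus
      χ² = represents-injective
        (represents-* e-periodic e-periodic χ-represents χ-represents)
        (represents-+ (represents-constant* (+ A) χ-represents) (represents-constant* (+ B) χ*-represents))
        self-product

      χ*² : ∃ λ h → (χ* *ᴾ χ*) +ᴾ map -_ (constant (+ A) *ᴾ χ* +ᴾ constant (+ B) *ᴾ χ) ≈ᴾ h *ᴾ modulus
      χ*² = represents-injective
        (represents-* e-periodic⁻ e-periodic⁻ χ*-represents χ*-represents)
        (represents-+ (represents-constant* (+ A) χ*-represents) (represents-constant* (+ B) χ-represents))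
        self-product*

      χχ* : ∃ λ h → (χ *ᴾ χ*) +ᴾ map -_ (constant (+ A) *ᴾ (χ +ᴾ χ*) +ᴾ constant (+ C) *ᴾ
        (upperSum i (suc m) +ᴾ constant 1ℤ)) ≈ᴾ h *ᴾ modulus
      χχ* = represents-injective
        (represents-* e-periodic e-periodic⁻ χ-represents χ*-represents)
        (represents-+ (represents-constant* (+ A) (represents-+ χ-represents χ*-represents))
                      (represents-constant* (+ C) rest-represents))
        mixed-product

theorem4p5 :
  (s t : ℕ) → 1 ≤ s → 1 ≤ t →
  (p q l : ℕ) → Prime p → Prime q → Prime l →
  p ≢ q → p ≢ l → q ≢ l →
  ¬ (2 ∣ p) → ¬ (2 ∣ q) → p % 4 ≡ 3 →
  Order (p ^ s) (+ l) (φ (p ^ s) / 2) →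
  Order (q ^ t) (+ l) (φ (q ^ t)) →
  gcd (φ (p ^ s)) (φ (q ^ t)) ≡ 2 →
  (g : ℤ) → PrimitiveRoot (p ^ s) g → PrimitiveRoot (q ^ t) g →
  (i : ℕ) → i < s →
  let open CyclicRing p q l s t g
      a = ⟦ (p ∸ 3) / 4 ℕ.* p ^ (s ∸ i ∸ 1) ⟧
      b = ⟦ (p ℕ.+ 1) / 4 ℕ.* p ^ (s ∸ i ∸ 1) ⟧
      c = ⟦ φ (p ^ (s ∸ i)) / 2 ⟧
  in
    (χ i t * χ i t ≈ a * χ i t + b * χ* i t)
    × (χ* i t * χ* i t ≈ a * χ* i t + b * χ i t)
    × (χ i t * χ* i t ≈ a * (χ i t + χ* i t) + c * (∑ (filter (i <?_) (upTo s)) (λ k → χ k t + χ* k t) + 1#))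
theorem4p5 (suc m) t _ _ p q l p-prime q-prime _ _ _ _ _ _ p%4≡3 order _ _ g root _ i (s≤s i≤m) =
  χ² , χ*² , χχ*
  where
  j : ℕ
  j = m ∸ i
  i+j≡m : i ℕ.+ j ≡ m
  i+j≡m = ℕ.m+[n∸m]≡n i≤m
  a : ℕ
  -- The remainder of p modulo 4 is 3, so the rounded quotient is (p - 3)/4.
  a = p / 4
  p≡ : p ≡ 3 ℕ.+ 4 ℕ.* a
  p≡ = trans (ℕ.m≡m%n+[m/n]*n p 4) (cong₂ ℕ._+_ p%4≡3 (ℕ.*-comm a 4))
  instance
    q^t≢0 : NonZero (q ^ t)
    q^t≢0 = ℕ.m^n≢0 q t {{prime⇒nonZero q-prime}}
  open Development.Cosets p a m p-prime p≡ (q ^ t) l g order root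
  s∸i≡1+j : suc m ∸ i ≡ suc j
  s∸i≡1+j = ℕ.+-∸-assoc 1 i≤m
  exponent : suc m ∸ i ∸ 1 ≡ j
  exponent = cong (_∸ 1) s∸i≡1+j
  [p∸3]/4≡a : (p ∸ 3) / 4 ≡ a
  [p∸3]/4≡a = trans (cong (λ z → (z ∸ 3) / 4) p≡) (trans (cong (_/ 4) (ℕ.*-comm 4 a)) (ℕ.m*n/n≡m a 4))
  [p+1]/4≡1+a : (p ℕ.+ 1) / 4 ≡ suc a
  [p+1]/4≡1+a = trans (cong (λ z → (z ℕ.+ 1) / 4) p≡) (trans (cong (_/ 4) (eq a)) (ℕ.m*n/n≡m (suc a) 4))
    where
    eq : ∀ a → 3 ℕ.+ 4 ℕ.* a ℕ.+ 1 ≡ suc a ℕ.* 4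
    eq = ℕ-Solver.solve-∀
  open Products i j i+j≡m 
    ((p ∸ 3) / 4 ℕ.* p ^ (suc m ∸ i ∸ 1)) ((p ℕ.+ 1) / 4 ℕ.* p ^ (suc m ∸ i ∸ 1)) (φ (p ^ (suc m ∸ i)) / 2)
    (cong₂ (λ x y → x ℕ.* p ^ y) [p∸3]/4≡a exponent) (cong₂ (λ x y → x ℕ.* p ^ y) [p+1]/4≡1+a exponent)
    (trans (cong (λ z → φ (p ^ z) / 2) s∸i≡1+j) (φ/2≡half j))
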